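{- For every $\varepsilon>0$ there is $n_0$ such that for every $n\ge n_0$ there exists an $n$-component increasing network $f$ with \[ \lambda(f)\ \ge\ \left(\frac1e-\varepsilon\right)n^2 . \]
   Context: An $n$-component (Boolean) network is a function $f=(f_1,\dots,f_n):\{0,1\}^n\to\{0,1\}^n$. Write $[n]=\{1,\dots,n\}$. For $i\in[n]$ and $x\in\{0,1\}^n$, $f^i(x):=(x_1,\dots,x_{i-1},f_i(x),x_{i+1},\dots,x_n)$. For a word $w=i_1i_2\dots i_k$ over the alphabet $[n]$, $f^w:=f^{i_k}\circ\cdots\circ f^{i_1}$ (and $f^\epsilon=\mathrm{id}$ for the empty word). A word $w$ fixes $f$ if $f^w(x)$ is a fixed point of $f$ for every $x\in\{0,1\}^n$; the fixing length $\lambda(f)$ is the minimum length of a word fixing $f$. The network $f$ is increasing if $x\le f(x)$ (componentwise) for all $x\in\{0,1\}^n$. (Increasing networks always admit a fixing word.) Here $e$ is Euler's number. -}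

module Defs where

open import Data.Bool.Base as Bool using (Bool)
open import Data.Fin.Base using (Fin)
open import Data.Integer.Base as ℤ using (+_)
import Data.Integer.Properties as ℤ
open import Data.List.Base using (List; []; _∷_; length)
open import Data.Nat.Base as ℕ using (ℕ; zero; suc; _!)
import Data.Nat.Properties as ℕ
open import Data.Product.Base using (∃-syntax; _×_; _,_; proj₁; proj₂)
open import Data.Rational.Base as ℚ
  using (ℚ; 0ℚ; 1ℚ; ½; ∣_∣; _+_; _-_; _*_; -_; 1/_; _/_; _<_; _≤_)
open import Data.Rational.Properties
open import Data.Rational.Solver using (module +-*-Solver)
import Data.Rational.Unnormalised.Base as ℚᵘ
import Data.Rational.Unnormalised.Properties as ℚᵘ
open import Data.Sum.Base using (inj₁; inj₂)
open import Data.Vec.Base using (Vec; lookup; _[_]≔_)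
open import Data.Vec.Relation.Binary.Pointwise.Inductive using (Pointwise)
open import Relation.Binary.PropositionalEquality

State : ℕ → Set
State n = Vec Bool n

Network : ℕ → Set
Network n = State n → State n

Word : ℕ → Set
Word n = List (Fin n)

_≤ˢ_ : ∀ {n} → State n → State n → Set
_≤ˢ_ = Pointwise Bool._≤_

Increasing : ∀ {n} → Network n → Set
Increasing f = ∀ x → x ≤ˢ f x

-- f^i
update : ∀ {n} → Network n → Fin n → Network n
update f i x = x [ i ]≔ lookup (f x) i

-- f^w: the first letter of the word acts first
run : ∀ {n} → Network n → Word n → Network n
run f []      x = x
run f (i ∷ w) x = run f w (update f i x)

Fixes : ∀ {n} → Word n → Network n → Set
Fixes w f = ∀ x → f (run f w x) ≡ run f w x

-- λ(f) = ℓ, as a relation because a network need not have a fixing word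
IsFixingLength : ∀ {n} → Network n → ℕ → Set
IsFixingLength {n} f ℓ =
  (∃[ w ] Fixes w f × length w ≡ ℓ) ×
  (∀ (w : Word n) → Fixes w f → ℓ ℕ.≤ length w)

-- Reals are represented by Cauchy sequences of rationals; x and y denote the
-- same real when x ≤ℝ y and y ≤ℝ x.

Cauchy : (ℕ → ℚ) → Set
Cauchy s = ∀ δ → 0ℚ < δ →
  ∃[ N ] (∀ m n → N ℕ.≤ m → N ℕ.≤ n → ∣ s m - s n ∣ < δ)

record ℝ : Set where
  constructor mkℝ
  field
    seq    : ℕ → ℚ
    cauchy : Cauchy seq

open ℝ public

infix 4 _<ℝ_ _≤ℝ_ _≥ℝ_

_<ℝ_ : ℝ → ℝ → Set
x <ℝ y = ∃[ δ ] 0ℚ < δ × ∃[ N ] (∀ m → N ℕ.≤ m → seq x m + δ ≤ seq y m)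

_≤ℝ_ : ℝ → ℝ → Set
x ≤ℝ y = ∀ δ → 0ℚ < δ → ∃[ N ] (∀ m → N ℕ.≤ m → seq x m ≤ seq y m + δ)

_≥ℝ_ : ℝ → ℝ → Set
x ≥ℝ y = y ≤ℝ x

private
  module _ where
    open +-*-Solver

    -[p-q]≡q-p : ∀ p q → - (p - q) ≡ q - p
    -[p-q]≡q-p = solve 2 (λ p q → :- (p :- q) := q :- p) refl

    p≡q+[p-q] : ∀ p q → p ≡ q + (p - q)
    p≡q+[p-q] = solve 2 (λ p q → p := q :+ (p :- q)) refl

    p+q-p≡q : ∀ p q → p + q - p ≡ q
    p+q-p≡q = solve 2 (λ p q → p :+ q :- p := q) refl

    difference-difference : ∀ a b c d → (a - b) - (c - d) ≡ (a - c) - (b - d)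
    difference-difference =
      solve 4 (λ a b c d → (a :- b) :- (c :- d) := (a :- c) :- (b :- d)) refl

    product-difference : ∀ a b c d → a * b - c * d ≡ a * (b - d) + d * (a - c)
    product-difference =
      solve 4 (λ a b c d → a :* b :- c :* d := a :* (b :- d) :+ d :* (a :- c)) refl

    reciprocal-difference : ∀ a b r s → r * (b * s) - s * (a * r) ≡ (b - a) * (r * s)
    reciprocal-difference =
      solve 4 (λ a b r s → r :* (b :* s) :- s :* (a :* r) := (b :- a) :* (r :* s)) refl

    product-interchange : ∀ δ a b r s → δ * (a * b) * (r * s) ≡ δ * ((a * r) * (b * s))
    product-interchange =
      solve 5 (λ δ a b r s → δ :* (a :* b) :* (r :* s) := δ :* ((a :* r) :* (b :* s))) refl

  0<½δ : ∀ {δ} → 0ℚ < δ → 0ℚ < δ * ½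
  0<½δ 0<δ = *-monoˡ-<-pos ½ 0<δ

  ½δ+½δ : ∀ δ → δ * ½ + δ * ½ ≡ δ
  ½δ+½δ δ = trans (sym (*-distribˡ-+ δ ½ ½)) (*-identityʳ δ)

  ∣p-q∣≡∣q-p∣ : ∀ p q → ∣ p - q ∣ ≡ ∣ q - p ∣
  ∣p-q∣≡∣q-p∣ p q = trans (sym (∣-p∣≡∣p∣ (p - q)))
    (cong ∣_∣ (-[p-q]≡q-p p q))

  0<∣p∣+1 : ∀ p → 0ℚ < ∣ p ∣ + 1ℚ
  0<∣p∣+1 p = +-mono-≤-< (0≤∣p∣ p) (positive⁻¹ 1ℚ)

fromℕ : ℕ → ℝ
fromℕ k = mkℝ (λ _ → + k / 1) λ δ 0<δ →
  0 , λ _ _ _ _ → subst (_< δ) (sym (cong ∣_∣ (+-inverseʳ (+ k / 1)))) 0<δ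

0ℝ : ℝ
0ℝ = fromℕ 0

private
  sub-cauchy : ∀ x y → Cauchy (λ m → seq x m - seq y m)
  sub-cauchy x y δ 0<δ with cauchy x (δ * ½) (0<½δ 0<δ) | cauchy y (δ * ½) (0<½δ 0<δ)
  ... | M , x-close | N , y-close = M ℕ.⊔ N , close
    where
    open ≤-Reasoning
    close : ∀ m n → M ℕ.⊔ N ℕ.≤ m → M ℕ.⊔ N ℕ.≤ n →
            ∣ (seq x m - seq y m) - (seq x n - seq y n) ∣ < δ
    close m n ≤m ≤n = begin-strict
      ∣ (seq x m - seq y m) - (seq x n - seq y n) ∣
        ≡⟨ cong ∣_∣ (difference-difference (seq x m) (seq y m) (seq x n) (seq y n)) ⟩
      ∣ (seq x m - seq x n) - (seq y m - seq y n) ∣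
        ≤⟨ ∣p-q∣≤∣p∣+∣q∣ (seq x m - seq x n) (seq y m - seq y n) ⟩
      ∣ seq x m - seq x n ∣ + ∣ seq y m - seq y n ∣
        <⟨ +-mono-< (x-close m n (ℕ.m⊔n≤o⇒m≤o M N ≤m) (ℕ.m⊔n≤o⇒m≤o M N ≤n))
                    (y-close m n (ℕ.m⊔n≤o⇒n≤o M N ≤m) (ℕ.m⊔n≤o⇒n≤o M N ≤n)) ⟩
      δ * ½ + δ * ½
        ≡⟨ ½δ+½δ δ ⟩
      δ ∎

infixl 6 _-ℝ_

_-ℝ_ : ℝ → ℝ → ℝ
x -ℝ y = mkℝ (λ m → seq x m - seq y m) (sub-cauchy x y)

private
  eventually-bounded : ∀ x → ∃[ B ] 0ℚ < B × ∃[ N ] (∀ m → N ℕ.≤ m → ∣ seq x m ∣ ≤ B)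
  eventually-bounded x with cauchy x 1ℚ (positive⁻¹ 1ℚ)
  ... | N , close = ∣ seq x N ∣ + 1ℚ , 0<∣p∣+1 (seq x N) , N , λ m N≤m → begin
      ∣ seq x m ∣
        ≡⟨ cong ∣_∣ (p≡q+[p-q] (seq x m) (seq x N)) ⟩
      ∣ seq x N + (seq x m - seq x N) ∣
        ≤⟨ ∣p+q∣≤∣p∣+∣q∣ (seq x N) (seq x m - seq x N) ⟩
      ∣ seq x N ∣ + ∣ seq x m - seq x N ∣
        ≤⟨ +-monoʳ-≤ ∣ seq x N ∣ (<⇒≤ (close m N N≤m ℕ.≤-refl)) ⟩
      ∣ seq x N ∣ + 1ℚ ∎
    where
    open ≤-Reasoning

  -- the precision η at which a factor must be known, given that the other
  -- factor is bounded by B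
  split : ∀ {B δ} → 0ℚ < B → 0ℚ < δ → ∃[ η ] 0ℚ < η × B * η ≡ δ * ½
  split {B} {δ} 0<B 0<δ = 1/ B * (δ * ½) , positive⁻¹ _ ,
    trans (sym (*-assoc B (1/ B) (δ * ½)))
      (trans (cong (_* (δ * ½)) (*-inverseʳ B)) (*-identityˡ (δ * ½)))
    where
    instance
      B-pos = ℚ.positive 0<B
      B≢0 = pos⇒nonZero B
      1/B-pos = 1/pos⇒pos B
      ½δ-pos = ℚ.positive (0<½δ 0<δ)
      η-pos = pos*pos⇒pos (1/ B) (δ * ½)

  ∣p∣*∣q∣< : ∀ {B η} p q → 0ℚ < B → ∣ p ∣ ≤ B → ∣ q ∣ < η → ∣ p ∣ * ∣ q ∣ < B * η
  ∣p∣*∣q∣< {B} {η} p q 0<B p≤B q<η = ≤-<-trans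
    (*-monoʳ-≤-nonNeg ∣ q ∣ {{∣-∣-nonNeg q}} p≤B)
    (*-monoʳ-<-pos B {{ℚ.positive 0<B}} q<η)

  mul-cauchy : ∀ x y → Cauchy (λ m → seq x m * seq y m)
  mul-cauchy x y δ 0<δ = P ℕ.⊔ Q , close
    where
    open ≤-Reasoning
    A-bound = eventually-bounded x
    B-bound = eventually-bounded y
    A = proj₁ A-bound
    B = proj₁ B-bound
    0<A = proj₁ (proj₂ A-bound)
    0<B = proj₁ (proj₂ B-bound)
    K = proj₁ (proj₂ (proj₂ A-bound))
    L = proj₁ (proj₂ (proj₂ B-bound))
    x≤A = proj₂ (proj₂ (proj₂ A-bound))
    y≤B = proj₂ (proj₂ (proj₂ B-bound))
    η-split = split 0<B 0<δ
    θ-split = split 0<A 0<δ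
    η = proj₁ η-split
    θ = proj₁ θ-split
    x-modulus = cauchy x η (proj₁ (proj₂ η-split))
    y-modulus = cauchy y θ (proj₁ (proj₂ θ-split))
    M = proj₁ x-modulus
    N = proj₁ y-modulus
    x-close = proj₂ x-modulus
    y-close = proj₂ y-modulus
    P = K ℕ.⊔ L
    Q = M ℕ.⊔ N
    close : ∀ m n → P ℕ.⊔ Q ℕ.≤ m → P ℕ.⊔ Q ℕ.≤ n →
            ∣ seq x m * seq y m - seq x n * seq y n ∣ < δ
    close m n ≤m ≤n = begin-strict
      ∣ a * b - c * d ∣
        ≡⟨ cong ∣_∣ (product-difference a b c d) ⟩
      ∣ a * (b - d) + d * (a - c) ∣
        ≤⟨ ∣p+q∣≤∣p∣+∣q∣ (a * (b - d)) (d * (a - c)) ⟩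
      ∣ a * (b - d) ∣ + ∣ d * (a - c) ∣
        ≡⟨ cong₂ _+_ (∣p*q∣≡∣p∣*∣q∣ a (b - d)) (∣p*q∣≡∣p∣*∣q∣ d (a - c)) ⟩
      ∣ a ∣ * ∣ b - d ∣ + ∣ d ∣ * ∣ a - c ∣
        <⟨ +-mono-<
             (∣p∣*∣q∣< a (b - d) 0<A (x≤A m (ℕ.m⊔n≤o⇒m≤o K L P≤m))
               (y-close m n (ℕ.m⊔n≤o⇒n≤o M N Q≤m) (ℕ.m⊔n≤o⇒n≤o M N Q≤n)))
             (∣p∣*∣q∣< d (a - c) 0<B (y≤B n (ℕ.m⊔n≤o⇒n≤o K L P≤n))
               (x-close m n (ℕ.m⊔n≤o⇒m≤o M N Q≤m) (ℕ.m⊔n≤o⇒m≤o M N Q≤n))) ⟩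
      A * θ + B * η
        ≡⟨ cong₂ _+_ (proj₂ (proj₂ θ-split)) (proj₂ (proj₂ η-split)) ⟩
      δ * ½ + δ * ½
        ≡⟨ ½δ+½δ δ ⟩
      δ ∎
      where
      a = seq x m
      b = seq y m
      c = seq x n
      d = seq y n
      P≤m = ℕ.m⊔n≤o⇒m≤o P Q ≤m
      P≤n = ℕ.m⊔n≤o⇒m≤o P Q ≤n
      Q≤m = ℕ.m⊔n≤o⇒n≤o P Q ≤m
      Q≤n = ℕ.m⊔n≤o⇒n≤o P Q ≤n

infixl 7 _*ℝ_

_*ℝ_ : ℝ → ℝ → ℝ
x *ℝ y = mkℝ (λ m → seq x m * seq y m) (mul-cauchy x y)

-- The reciprocal sequence is shifted by the index from
-- which the witness of positivity bounds the terms below.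
module Reciprocal (x : ℝ) (0<x : 0ℝ <ℝ x) where

  lower : ℚ
  lower = proj₁ 0<x

  shift : ℕ
  shift = proj₁ (proj₂ (proj₂ 0<x))

  term : ℕ → ℚ
  term m = seq x (shift ℕ.+ m)

  0<lower : 0ℚ < lower
  0<lower = proj₁ (proj₂ 0<x)

  lower≤term : ∀ m → lower ≤ term m
  lower≤term m = subst (_≤ term m) (+-identityˡ lower)
    (proj₂ (proj₂ (proj₂ 0<x)) (shift ℕ.+ m) (ℕ.m≤m+n shift m))

  instance
    lower-pos : ℚ.Positive lower
    lower-pos = ℚ.positive 0<lower

  term-pos : ∀ m → ℚ.Positive (term m)
  term-pos m = ℚ.positive (<-≤-trans 0<lower (lower≤term m))

  recip : ℕ → ℚ
  recip m = (1/ term m) {{pos⇒nonZero (term m) {{term-pos m}}}}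

  recip-pos : ∀ m → ℚ.Positive (recip m)
  recip-pos m = 1/pos⇒pos (term m) {{term-pos m}}

  term*recip : ∀ m → term m * recip m ≡ 1ℚ
  term*recip m = *-inverseʳ (term m) {{pos⇒nonZero (term m) {{term-pos m}}}}

  recip-cauchy : Cauchy recip
  recip-cauchy δ 0<δ with cauchy x (δ * (lower * lower)) (positive⁻¹ _)
    where
    instance
      δ-pos = ℚ.positive 0<δ
      l²-pos = pos*pos⇒pos lower lower
      δl²-pos = pos*pos⇒pos δ (lower * lower)
  ... | N , x-close = N , close
    where
    open ≤-Reasoning
    close : ∀ m n → N ℕ.≤ m → N ℕ.≤ n → ∣ recip m - recip n ∣ < δ
    close m n N≤m N≤n = begin-strict
      ∣ r - s ∣
        ≡⟨ cong ∣_∣ r-s≡ ⟩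
      ∣ (b - a) * (r * s) ∣
        ≡⟨ ∣p*q∣≡∣p∣*∣q∣ (b - a) (r * s) ⟩
      ∣ b - a ∣ * ∣ r * s ∣
        ≡⟨ cong (∣ b - a ∣ *_) (0≤p⇒∣p∣≡p (<⇒≤ (positive⁻¹ (r * s)))) ⟩
      ∣ b - a ∣ * (r * s)
        <⟨ *-monoˡ-<-pos (r * s) (x-close (shift ℕ.+ n) (shift ℕ.+ m)
             (ℕ.m≤n⇒m≤o+n shift N≤n) (ℕ.m≤n⇒m≤o+n shift N≤m)) ⟩
      δ * (lower * lower) * (r * s)
        ≤⟨ *-monoʳ-≤-nonNeg (r * s) (*-monoˡ-≤-nonNeg δ lower²≤) ⟩
      δ * (a * b) * (r * s)
        ≡⟨ product-interchange δ a b r s ⟩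
      δ * ((a * r) * (b * s))
        ≡⟨ cong (δ *_) (cong₂ _*_ (term*recip m) (term*recip n)) ⟩
      δ * 1ℚ
        ≡⟨ *-identityʳ δ ⟩
      δ ∎
      where
      a = term m
      b = term n
      r = recip m
      s = recip n
      instance
        r-pos = recip-pos m
        s-pos = recip-pos n
        b-nonNeg = pos⇒nonNeg b {{term-pos n}}
        l-nonNeg = pos⇒nonNeg lower
        δ-nonNeg = ℚ.nonNegative (<⇒≤ 0<δ)
        rs-pos = pos*pos⇒pos r s
        rs-nonNeg = pos⇒nonNeg (r * s)
      lower²≤ : lower * lower ≤ a * b
      lower²≤ = ≤-trans (*-monoˡ-≤-nonNeg lower (lower≤term n))
                        (*-monoʳ-≤-nonNeg b (lower≤term m))
      r-s≡ : r - s ≡ (b - a) * (r * s)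
      r-s≡ = begin-equality
        r - s
          ≡⟨ cong₂ _-_ (*-identityʳ r) (*-identityʳ s) ⟨
        r * 1ℚ - s * 1ℚ
          ≡⟨ cong₂ (λ u v → r * u - s * v) (term*recip n) (term*recip m) ⟨
        r * (b * s) - s * (a * r)
          ≡⟨ reciprocal-difference a b r s ⟩
        (b - a) * (r * s) ∎

1/ℝ : (x : ℝ) → 0ℝ <ℝ x → ℝ
1/ℝ x 0<x = mkℝ recip recip-cauchy
  where open Reciprocal x 0<x

1/[_]! : ℕ → ℚ
1/[ k ]! = (+ 1 / (k !)) {{k ℕ.!≢0}}

eSum : ℕ → ℚ
eSum zero    = 1/[ 0 ]!
eSum (suc m) = eSum m + 1/[ suc m ]!

toℚᵘ-/ : ∀ i d → ℚ.toℚᵘ (i / suc d) ℚᵘ.≃ ℚᵘ.mkℚᵘ i d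
toℚᵘ-/ i d = toℚᵘ-fromℚᵘ (ℚᵘ.mkℚᵘ i d)

1/a<i/b : ∀ i a b .{{_ : ℕ.NonZero a}} .{{_ : ℕ.NonZero b}} →
          + b ℤ.< i ℤ.* + a → + 1 / a < i / b
1/a<i/b i (suc a) (suc b) b<ia = toℚᵘ-cancel-< (begin-strict
  ℚ.toℚᵘ (+ 1 / suc a)  ≃⟨ toℚᵘ-/ (+ 1) a ⟩
  ℚᵘ.mkℚᵘ (+ 1) a       <⟨ ℚᵘ.*<* (subst (ℤ._< i ℤ.* + suc a) (sym (ℤ.*-identityˡ (+ suc b))) b<ia) ⟩
  ℚᵘ.mkℚᵘ i b           ≃⟨ toℚᵘ-/ i b ⟨
  ℚ.toℚᵘ (i / suc b)    ∎)
  where open ℚᵘ.≤-Reasoning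

1/a+1/a≤1/b : ∀ a b .{{_ : ℕ.NonZero a}} .{{_ : ℕ.NonZero b}} →
              b ℕ.+ b ℕ.≤ a → + 1 / a + + 1 / a ≤ + 1 / b
1/a+1/a≤1/b (suc a) (suc b) 2b≤a = toℚᵘ-cancel-≤ (begin
  ℚ.toℚᵘ (+ 1 / suc a + + 1 / suc a)
    ≃⟨ toℚᵘ-homo-+ (+ 1 / suc a) (+ 1 / suc a) ⟩
  ℚ.toℚᵘ (+ 1 / suc a) ℚᵘ.+ ℚ.toℚᵘ (+ 1 / suc a)
    ≃⟨ ℚᵘ.+-cong (toℚᵘ-/ (+ 1) a) (toℚᵘ-/ (+ 1) a) ⟩
  ℚᵘ.mkℚᵘ (+ 1) a ℚᵘ.+ ℚᵘ.mkℚᵘ (+ 1) a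
    ≤⟨ ℚᵘ.*≤* (ℤ.+≤+ cross) ⟩
  ℚᵘ.mkℚᵘ (+ 1) b
    ≃⟨ toℚᵘ-/ (+ 1) b ⟨
  ℚ.toℚᵘ (+ 1 / suc b) ∎)
  where
  open ℚᵘ.≤-Reasoning
  A = suc a
  B = suc b
  cross : (1 ℕ.* A ℕ.+ 1 ℕ.* A) ℕ.* B ℕ.≤ 1 ℕ.* (A ℕ.* A)
  cross = subst₂ ℕ._≤_
    (trans (ℕ.*-distribˡ-+ A B B) (trans (sym (ℕ.*-distribʳ-+ B A A))
      (cong (ℕ._* B) (sym (cong₂ ℕ._+_ (ℕ.*-identityˡ A) (ℕ.*-identityˡ A))))))
    (sym (ℕ.*-identityˡ (A ℕ.* A)))
    (ℕ.*-monoʳ-≤ A 2b≤a)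

0<1/k! : ∀ k → 0ℚ < 1/[ k ]!
0<1/k! k = positive⁻¹ (1/[ k ]!) {{normalize-pos 1 (k !) {{k ℕ.!≢0}}}}

1/[2+m]!-halves : ∀ m → 1/[ suc (suc m) ]! + 1/[ suc (suc m) ]! ≤ 1/[ suc m ]!
1/[2+m]!-halves m = 1/a+1/a≤1/b (suc (suc m) !) (suc m !)
  {{suc (suc m) ℕ.!≢0}} {{suc m ℕ.!≢0}}
  (ℕ.+-monoʳ-≤ (suc m !) (ℕ.m≤m+n (suc m !) (m ℕ.* suc m !)))

eSum-increasing : ∀ m k → eSum m ≤ eSum (k ℕ.+ m)
eSum-increasing m zero    = ≤-refl
eSum-increasing m (suc k) = ≤-trans (eSum-increasing m k)
  (subst (_≤ eSum (suc k ℕ.+ m)) (+-identityʳ (eSum (k ℕ.+ m)))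
    (+-monoʳ-≤ (eSum (k ℕ.+ m)) (<⇒≤ (0<1/k! (suc k ℕ.+ m)))))

-- m ↦ eSum m + 1/[ m ]! is nonincreasing from m = 1 on
eSum-upper : ∀ m k → eSum (k ℕ.+ suc m) + 1/[ k ℕ.+ suc m ]! ≤ eSum (suc m) + 1/[ suc m ]!
eSum-upper m zero    = ≤-refl
eSum-upper m (suc k) = ≤-trans step (eSum-upper m k)
  where
  open ≤-Reasoning
  l = k ℕ.+ suc m
  halves : ∀ l → suc m ℕ.≤ l → 1/[ suc l ]! + 1/[ suc l ]! ≤ 1/[ l ]!
  halves (suc l) _ = 1/[2+m]!-halves l
  step : eSum l + 1/[ suc l ]! + 1/[ suc l ]! ≤ eSum l + 1/[ l ]!
  step = begin
    eSum l + 1/[ suc l ]! + 1/[ suc l ]!    ≡⟨ +-assoc (eSum l) (1/[ suc l ]!) (1/[ suc l ]!) ⟩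
    eSum l + (1/[ suc l ]! + 1/[ suc l ]!)  ≤⟨ +-monoʳ-≤ (eSum l) (halves l (ℕ.m≤n+m (suc m) k)) ⟩
    eSum l + 1/[ l ]!                     ∎

eSum-gap : ∀ m k → ∣ eSum (k ℕ.+ suc m) - eSum (suc m) ∣ ≤ 1/[ suc m ]!
eSum-gap m k = begin
  ∣ s - t ∣      ≡⟨ 0≤p⇒∣p∣≡p (subst (_≤ s - t) (+-inverseʳ t) (+-monoˡ-≤ (- t) (eSum-increasing (suc m) k))) ⟩
  s - t          ≤⟨ +-monoˡ-≤ (- t) s≤t+1/m! ⟩
  t + u - t      ≡⟨ p+q-p≡q t u ⟩
  u              ∎
  where
  open ≤-Reasoning
  s = eSum (k ℕ.+ suc m)
  t = eSum (suc m)
  u = 1/[ suc m ]!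
  s≤t+1/m! : s ≤ t + u
  s≤t+1/m! = ≤-trans
    (subst (_≤ s + 1/[ k ℕ.+ suc m ]!) (+-identityʳ s)
      (+-monoʳ-≤ s (<⇒≤ (0<1/k! (k ℕ.+ suc m)))))
    (eSum-upper m k)

n≤n! : ∀ n → n ℕ.≤ n !
n≤n! zero    = ℕ.z≤n
n≤n! (suc n) = subst (ℕ._≤ suc n !) (ℕ.*-identityʳ (suc n))
  (ℕ.*-monoʳ-≤ (suc n) (ℕ.>-nonZero⁻¹ (n !) {{n ℕ.!≢0}}))

b<ic : ∀ i b c → ℤ.Positive i → b ℕ.< c → + b ℤ.< i ℤ.* + c
b<ic ℤ.+[1+ p ] b c _ b<c = subst (+ b ℤ.<_) (ℤ.pos-* (suc p) c)
  (ℤ.+<+ (ℕ.<-≤-trans b<c (ℕ.m≤m+n c (p ℕ.* c))))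

1/m!-small : ∀ δ → 0ℚ < δ → ∀ m → suc (ℚ.↧ₙ δ) ℕ.≤ m → 1/[ m ]! < δ
1/m!-small δ@(ℚ.mkℚ _ _ _) 0<δ m ≤m = subst (1/[ m ]! <_) (↥p/↧p≡p δ)
  (1/a<i/b (ℚ.↥ δ) (m !) (ℚ.↧ₙ δ) {{m ℕ.!≢0}}
    (b<ic (ℚ.↥ δ) (ℚ.↧ₙ δ) (m !) (ℚ.positive 0<δ)
      (ℕ.≤-trans ≤m (n≤n! m))))

eSum-cauchy : Cauchy eSum
eSum-cauchy δ 0<δ = N , close
  where
  N = suc (ℚ.↧ₙ δ)
  ordered : ∀ m n → N ℕ.≤ m → m ℕ.≤ n → ∣ eSum n - eSum m ∣ < δ
  ordered (suc m) n N≤m m≤n = ≤-<-trans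
    (subst (λ l → ∣ eSum l - eSum (suc m) ∣ ≤ 1/[ suc m ]!) (ℕ.m∸n+n≡m m≤n)
      (eSum-gap m (n ℕ.∸ suc m)))
    (1/m!-small δ 0<δ (suc m) N≤m)
  close : ∀ m n → N ℕ.≤ m → N ℕ.≤ n → ∣ eSum m - eSum n ∣ < δ
  close m n N≤m N≤n with ℕ.≤-total m n
  ... | inj₁ m≤n = subst (_< δ) (∣p-q∣≡∣q-p∣ (eSum n) (eSum m)) (ordered m n N≤m m≤n)
  ... | inj₂ n≤m = ordered n m N≤n n≤m

e : ℝ
e = mkℝ eSum eSum-cauchy

0<e : 0ℝ <ℝ e
0<e = 1ℚ , positive⁻¹ 1ℚ , 0 , λ m _ →
  subst₂ _≤_ (sym (+-identityˡ 1ℚ)) (cong eSum (ℕ.+-identityʳ m)) (eSum-increasing 0 m)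

1/e : ℝ
1/e = 1/ℝ e 0<e

{-# OPTIONS --safe #-}

-- Let q and k be large and let each state of k or more spare components select a sequence of distinct
-- letters among N = qk others.  The network that always sets the first unset letter of the selected
-- sequence is increasing, and every word fixing it contains all the selected sequences as subsequences.
--
-- Cut a sequence of N letters into q blocks of length k.  If it is a subsequence of a word of length less
-- than qs, then some block is a subsequence of s consecutive letters of the word.  For s = kr, such a
-- window has at most (s choose k) ≤ r^k (1 + 1/r)^(kr) ≤ (e r)^k subsequences of length k, exponentially
-- few among the at least (N - k)^k possible blocks once e r is a little below N - k.  So, on average over
-- the sequences, at least half of any given set of words of length below qs ≈ N²/e avoid the sequence.
-- Choosing sequences one after the other, each avoided by half of the words that contain all previous
-- ones, polynomially many sequences suffice to exclude all words of length below qs.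

module Submission where

open import Defs
open import Data.Bool.Base using (Bool; true; false; if_then_else_; b≤b; f≤t)
import Data.Bool.Properties as Bool
open import Data.Fin.Base using (Fin; zero; suc; _↑ˡ_; _↑ʳ_; splitAt)
import Data.Fin.Properties as Fin
open import Data.Integer.Base as ℤ using (+[1+_])
import Data.Integer.Properties as ℤ
open import Data.List.Base using (List; []; _∷_; [_]; _++_; length; map; concat; concatMap; filter; allFin)
import Data.List.Properties as List
open import Data.List.Membership.Propositional using (_∈_; find; lose)
import Data.List.Membership.Propositional.Properties as ∈
open import Data.List.Relation.Binary.Permutation.Propositional
  using (_↭_; ↭-refl; ↭-reflexive; ↭-trans; ↭-prep; ↭-swap; ↭⇒↭ₛ)
import Data.List.Relation.Binary.Permutation.Propositional.Properties as ↭
import Data.List.Relation.Binary.Permutation.Setoid.Properties as ↭ₛ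
import Data.List.Relation.Binary.Sublist.DecPropositional as DecSublist
open import Data.List.Relation.Binary.Sublist.Propositional using (_⊆_; []; _∷_; _∷ʳ_; minimum)
open import Data.List.Relation.Unary.All as All using (All; []; _∷_)
import Data.List.Relation.Unary.All.Properties as All
open import Data.List.Relation.Unary.AllPairs using ([]; _∷_)
open import Data.List.Relation.Unary.Any using (here; there)
open import Data.List.Relation.Unary.Unique.Propositional using (Unique)
import Data.List.Relation.Unary.Unique.Propositional.Properties as Unique
open import Data.Nat.Base
open import Data.Nat.DivMod using (m≡m%n+[m/n]*n; m%n<n; m/n*n≤m; /-monoˡ-≤; m*n/n≡m; m≥n⇒m/n>0)
open import Data.Nat.ListAction using (sum)
open import Data.Nat.ListAction.Properties using (sum-++)
open import Data.Nat.Properties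
open import Data.Nat.Tactic.RingSolver using (solve-∀)
open import Data.Product.Base using (∃-syntax; ∃₂; Σ-syntax; _×_; _,_; proj₁; proj₂)
open import Data.Rational.Base as ℚ using (ℚ; mkℚ; 0ℚ; 1ℚ)
import Data.Rational.Properties as ℚ
open import Data.Rational.Solver using (module +-*-Solver)
import Data.Rational.Unnormalised.Base as ℚᵘ
import Data.Rational.Unnormalised.Properties as ℚᵘ
open import Data.Sum.Base using (_⊎_; inj₁; inj₂)
open import Data.Vec.Base as Vec using ([]; _∷_; lookup; tabulate; replicate; _[_]≔_)
import Data.Vec.Properties as Vec
open import Data.Vec.Relation.Binary.Pointwise.Inductive as Pointwise using ([]; _∷_)
open import Function.Base using (_∘_; id)
open import Relation.Binary.Definitions using (DecidableEquality)
open import Relation.Binary.PropositionalEquality hiding ([_])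
open import Relation.Nullary using (Dec; yes; no; ¬_; contradiction; does)
open import Relation.Nullary.Decidable using (map′)
open import Relation.Unary using (Decidable)

private variable
  X Y : Set

-- Fixing length of increasing networks

states : ∀ n → List (State n)
states zero    = [ [] ]
states (suc n) = map (false ∷_) (states n) ++ map (true ∷_) (states n)

∈-states : ∀ {n} (x : State n) → x ∈ states n
∈-states []          = here refl
∈-states (false ∷ x) = ∈.∈-++⁺ˡ (∈.∈-map⁺ (false ∷_) (∈-states x))
∈-states (true ∷ x)  = ∈.∈-++⁺ʳ _ (∈.∈-map⁺ (true ∷_) (∈-states x))

_≟ˢ_ : ∀ {n} (x y : State n) → Dec (x ≡ y)
_≟ˢ_ = Vec.≡-dec Bool._≟_

fixes? : ∀ {n} (f : Network n) w → Dec (Fixes w f)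
fixes? {n} f w = map′ (λ fixed x → All.lookup fixed (∈-states x)) (λ fixes → All.tabulate λ {x} _ → fixes x)
  (All.all? (λ x → f (run f w x) ≟ˢ run f w x) (states n))

-- A least length can be computed only if the existence of a fixing word of a given length is
-- decidable. The finitely many words are searched letter by letter.
word? : ∀ {n} {P : Word n → Set} → (∀ w → Dec (P w)) → ∀ ℓ → Dec (∃[ w ] P w × length w ≡ ℓ)
word? P? zero    = map′ (λ p → [] , p , refl) (λ { ([] , p , _) → p }) (P? [])
word? P? (suc ℓ) = map′
  (λ { (i , w , p , eq) → i ∷ w , p , cong suc eq })
  (λ { (i ∷ w , p , eq) → i , w , p , suc-injective eq })
  (Fin.any? λ i → word? (P? ∘ (i ∷_)) ℓ)

least : {P : ℕ → Set} → (∀ m → Dec (P m)) → ∀ m → P m → ∃[ l ] P l × (∀ k → P k → l ≤ k)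
least P? zero    p = 0 , p , λ _ _ → z≤n
least P? (suc m) p with P? 0
... | yes p₀ = 0 , p₀ , λ _ _ → z≤n
... | no ¬p₀ with least (P? ∘ suc) m p
...   | l , pl , minimal = suc l , pl , λ { zero p₀ → contradiction p₀ ¬p₀ ; (suc k) pk → s≤s (minimal k pk) }

run-++ : ∀ {n} (f : Network n) u v x → run f (u ++ v) x ≡ run f v (run f u x)
run-++ f []      v x = refl
run-++ f (i ∷ u) v x = run-++ f u v (update f i x)

run-fixed : ∀ {n} (f : Network n) w {x} → f x ≡ x → run f w x ≡ x
run-fixed f []      _     = refl
run-fixed f (i ∷ w) {x} fixed = begin
  run f w (x [ i ]≔ lookup (f x) i) ≡⟨ cong (λ y → run f w (x [ i ]≔ lookup y i)) fixed ⟩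
  run f w (x [ i ]≔ lookup x i)     ≡⟨ cong (run f w) (Vec.[]≔-lookup x i) ⟩
  run f w x                         ≡⟨ run-fixed f w fixed ⟩
  x                                 ∎
  where open ≡-Reasoning

falses : ∀ {n} → State n → ℕ
falses []          = 0
falses (true ∷ x)  = falses x
falses (false ∷ x) = suc (falses x)

falses-set : ∀ {n} (x : State n) i → lookup x i ≡ false → falses x ≡ suc (falses (x [ i ]≔ true))
falses-set (false ∷ x) zero    _  = refl
falses-set (true ∷ x)  (suc i) xᵢ = falses-set x i xᵢ
falses-set (false ∷ x) (suc i) xᵢ = cong suc (falses-set x i xᵢ)

ascent : ∀ {n} (x y : State n) → x ≤ˢ y →
         y ≡ x ⊎ ∃[ i ] lookup x i ≡ false × lookup y i ≡ true
ascent []       []       []          = inj₁ refl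
ascent (_ ∷ _)  (_ ∷ _)  (f≤t ∷ _)   = inj₂ (zero , refl , refl)
ascent (b ∷ x)  (.b ∷ y) (b≤b ∷ x≤y) with ascent x y x≤y
... | inj₁ y≡x           = inj₁ (cong (b ∷_) y≡x)
... | inj₂ (i , xᵢ , yᵢ) = inj₂ (suc i , xᵢ , yᵢ)

module _ {n} {f : Network n} (incr : Increasing f) where

  -- A state that is not fixed has a component that `f` raises from false to true. Updating it
  -- lowers `falses` by one, so at most `falses x` letters are needed.
  fixed-reachable : ∀ m x → falses x ≤ m → ∃[ w ] f (run f w x) ≡ run f w x
  fixed-reachable m x falses≤m with ascent x (f x) (incr x)
  fixed-reachable m       x falses≤m | inj₁ fixed = [] , fixed
  fixed-reachable zero    x falses≤0 | inj₂ (i , xᵢ , _) =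
    contradiction (subst (_≤ 0) (falses-set x i xᵢ) falses≤0) λ ()
  fixed-reachable (suc m) x falses≤m | inj₂ (i , xᵢ , fxᵢ)
    with fixed-reachable m (x [ i ]≔ true) (s≤s⁻¹ (subst (_≤ suc m) (falses-set x i xᵢ) falses≤m))
  ... | w , fixed = i ∷ w , subst (λ b → f (run f w (x [ i ]≔ b)) ≡ run f w (x [ i ]≔ b)) (sym fxᵢ) fixed

  -- Words for the single states are concatenated. A state that an earlier part has brought to a
  -- fixed point stays there under all later letters.
  fixing-word : ∀ xs → ∃[ w ] All (λ x → f (run f w x) ≡ run f w x) xs
  fixing-word []       = [] , []
  fixing-word (x ∷ xs) with fixing-word xs
  ... | u , u-fixes with fixed-reachable _ (run f u x) ≤-refl
  ...   | v , v-fixes = u ++ v ,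
    subst (λ y → f y ≡ y) (sym (run-++ f u v x)) v-fixes ∷
    All.map (λ {y} fixed → subst (λ z → f z ≡ z)
      (sym (trans (run-++ f u v y) (run-fixed f v fixed))) fixed) u-fixes

  fixing-length : ∃[ ℓ ] IsFixingLength f ℓ
  fixing-length with fixing-word (states n)
  ... | u , u-fixes
    with least (word? (fixes? f)) (length u) (u , (λ x → All.lookup u-fixes (∈-states x)) , refl)
  ...   | ℓ , attained , minimal = ℓ , attained , λ w fixes → minimal (length w) (w , fixes , refl)

-- Networks following a prescribed family of sequences

setFirst : ∀ {n} → List (Fin n) → Network n
setFirst []      z = z
setFirst (i ∷ σ) z = if lookup z i then setFirst σ z else z [ i ]≔ true

set-≥ : ∀ {n} (z : State n) i → z ≤ˢ (z [ i ]≔ true)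
set-≥ (b ∷ z) zero    = Bool.≤-maximum b ∷ Pointwise.refl b≤b
set-≥ (b ∷ z) (suc i) = b≤b ∷ set-≥ z i

setFirst-increasing : ∀ {n} (σ : List (Fin n)) → Increasing (setFirst σ)
setFirst-increasing []      z = Pointwise.refl b≤b
setFirst-increasing (i ∷ σ) z with lookup z i
... | true  = setFirst-increasing σ z
... | false = set-≥ z i

setFirst-skip : ∀ {n} {z : State n} {pre} rest → All (λ i → lookup z i ≡ true) pre →
                setFirst (pre ++ rest) z ≡ setFirst rest z
setFirst-skip rest []           = refl
setFirst-skip {z = z} {i ∷ _} rest (zᵢ ∷ zs) rewrite zᵢ = setFirst-skip rest zs

setFirst-unset : ∀ {n} {z : State n} {i} rest → lookup z i ≡ false → setFirst (i ∷ rest) z ≡ z [ i ]≔ true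
setFirst-unset rest zᵢ rewrite zᵢ = refl

module _ {N t : ℕ} where

  Low : Fin (N + t) → Set
  Low i = ∃[ j ] i ≡ j ↑ˡ t

  -- The last `t` components are the selector. Setting letters, which are low components, leaves it
  -- unchanged, so one sequence is followed throughout a run from `initial y`.
  index : State (N + t) → State t
  index z = tabulate λ l → lookup z (N ↑ʳ l)

  low≢high : ∀ (j : Fin N) (l : Fin t) → N ↑ʳ l ≢ j ↑ˡ t
  low≢high j l eq with trans (sym (Fin.splitAt-↑ˡ N j t)) (trans (cong (splitAt N) (sym eq)) (Fin.splitAt-↑ʳ N t l))
  ... | ()

  index-set : ∀ z {i} b → Low i → index (z [ i ]≔ b) ≡ index z
  index-set z b (j , refl) = Vec.tabulate-cong λ l → Vec.lookup∘update′ (low≢high j l) z b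

  initial : State t → State (N + t)
  initial y = replicate N false Vec.++ y

  index-initial : ∀ y → index (initial y) ≡ y
  index-initial y = trans (Vec.tabulate-cong λ l → Vec.lookup-++ʳ (replicate N false) y l) (Vec.tabulate∘lookup y)

  lookup-initial : ∀ y {i} → Low i → lookup (initial y) i ≡ false
  lookup-initial y (j , refl) = trans (Vec.lookup-++ˡ (replicate N false) y j) (Vec.lookup-replicate j false)

  module _ (G : State t → List (Fin (N + t))) where

    follow : Network (N + t)
    follow z = setFirst (G (index z)) z

    follow-increasing : Increasing follow
    follow-increasing z = setFirst-increasing (G (index z)) z

    remaining-⊆ : ∀ w z pre rest → G (index z) ≡ pre ++ rest →
                  All (λ i → lookup z i ≡ true) pre → All (λ i → lookup z i ≡ false) rest →
                  Unique rest → All Low rest →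
                  follow (run follow w z) ≡ run follow w z → rest ⊆ w
    remaining-⊆ w z pre [] _ _ _ _ _ _ = minimum w
    remaining-⊆ w z pre (a ∷ rest) G≡ set (zₐ ∷ unset) (a≢ ∷ unique) (low ∷ lows) fixed = go w fixed
      where
      follow-z : follow z ≡ z [ a ]≔ true
      follow-z = trans (cong (λ σ → setFirst σ z) G≡)
        (trans (setFirst-skip (a ∷ rest) set) (setFirst-unset rest zₐ))

      go : ∀ w → follow (run follow w z) ≡ run follow w z → a ∷ rest ⊆ w
      -- With no letter left `z` itself would be fixed, although `follow` sets `a` in it.
      go [] fixed = contradiction
        (trans (sym zₐ) (trans (cong (λ x → lookup x a) (trans (sym fixed) follow-z)) (Vec.lookup∘update a z true))) λ ()
      go (i ∷ w) fixed with a Fin.≟ i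
      ... | yes refl = refl ∷ remaining-⊆ w (z [ a ]≔ true) (pre ++ [ a ]) rest
        (trans (cong G (index-set z true low)) (trans G≡ (sym (List.++-assoc pre [ a ] rest))))
        (All.++⁺ (All.map (λ {j} zⱼ → still-set j zⱼ) set) (Vec.lookup∘update a z true ∷ []))
        (All.zipWith (λ { (a≢j , zⱼ) → trans (Vec.lookup∘update′ (a≢j ∘ sym) z true) zⱼ }) (a≢ , unset))
        unique lows
        (subst (λ x → follow (run follow w x) ≡ run follow w x) step fixed)
        where
        step : update follow a z ≡ z [ a ]≔ true
        step = cong (z [ a ]≔_) (trans (cong (λ x → lookup x a) follow-z) (Vec.lookup∘update a z true))
        still-set : ∀ j → lookup z j ≡ true → lookup (z [ a ]≔ true) j ≡ true
        still-set j zⱼ with j Fin.≟ a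
        ... | yes refl = Vec.lookup∘update a z true
        ... | no j≢a   = trans (Vec.lookup∘update′ j≢a z true) zⱼ
      ... | no a≢i = i ∷ʳ go w (subst (λ x → follow (run follow w x) ≡ run follow w x) step fixed)
        where
        step : update follow i z ≡ z
        step = trans (cong (z [ i ]≔_) (trans (cong (λ x → lookup x i) follow-z)
          (Vec.lookup∘update′ (a≢i ∘ sym) z true))) (Vec.[]≔-lookup z i)

    fixes⇒⊆ : (∀ y → Unique (G y)) → (∀ y → All Low (G y)) →
              ∀ w → Fixes w follow → ∀ y → G y ⊆ w
    fixes⇒⊆ unique low w fixes y = remaining-⊆ w (initial y) [] (G y) (cong G (index-initial y)) []
      (All.map (lookup-initial y) (low y)) (unique y) (low y) (fixes (initial y))

-- Finite sums

∑ : List X → (X → ℕ) → ℕ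
∑ xs f = sum (map f xs)

∑-++ : ∀ xs ys (f : X → ℕ) → ∑ (xs ++ ys) f ≡ ∑ xs f + ∑ ys f
∑-++ xs ys f = trans (cong sum (List.map-++ f xs ys)) (sum-++ (map f xs) (map f ys))

∑-map : ∀ (g : X → Y) xs (f : Y → ℕ) → ∑ (map g xs) f ≡ ∑ xs (f ∘ g)
∑-map g xs f = cong sum (sym (List.map-∘ xs))

∑-concatMap : ∀ (g : X → List Y) xs (f : Y → ℕ) → ∑ (concatMap g xs) f ≡ ∑ xs (λ x → ∑ (g x) f)
∑-concatMap g []       f = refl
∑-concatMap g (x ∷ xs) f = trans (∑-++ (g x) (concatMap g xs) f) (cong (∑ (g x) f +_) (∑-concatMap g xs f))

∑-cong : ∀ xs {f g : X → ℕ} → (∀ {x} → x ∈ xs → f x ≡ g x) → ∑ xs f ≡ ∑ xs g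
∑-cong []       f≡g = refl
∑-cong (x ∷ xs) f≡g = cong₂ _+_ (f≡g (here refl)) (∑-cong xs (f≡g ∘ there))

∑-mono : ∀ xs {f g : X → ℕ} → (∀ {x} → x ∈ xs → f x ≤ g x) → ∑ xs f ≤ ∑ xs g
∑-mono []       f≤g = z≤n
∑-mono (x ∷ xs) f≤g = +-mono-≤ (f≤g (here refl)) (∑-mono xs (f≤g ∘ there))

∑-+ : ∀ xs (f g : X → ℕ) → ∑ xs (λ x → f x + g x) ≡ ∑ xs f + ∑ xs g
∑-+ []       f g = refl
∑-+ (x ∷ xs) f g = trans (cong (f x + g x +_) (∑-+ xs f g)) (interchange (f x) (g x) (∑ xs f) (∑ xs g))
  where
  interchange : ∀ a b c d → a + b + (c + d) ≡ a + c + (b + d)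
  interchange = solve-∀

∑-*ˡ : ∀ c xs (f : X → ℕ) → ∑ xs (λ x → c * f x) ≡ c * ∑ xs f
∑-*ˡ c []       f = sym (*-zeroʳ c)
∑-*ˡ c (x ∷ xs) f = trans (cong (c * f x +_) (∑-*ˡ c xs f)) (sym (*-distribˡ-+ c (f x) (∑ xs f)))

∑-*ʳ : ∀ c xs (f : X → ℕ) → ∑ xs (λ x → f x * c) ≡ ∑ xs f * c
∑-*ʳ c xs f = trans (∑-cong xs λ {x} _ → *-comm (f x) c) (trans (∑-*ˡ c xs f) (*-comm c (∑ xs f)))

∑-const : ∀ (xs : List X) c → ∑ xs (λ _ → c) ≡ length xs * c
∑-const []       c = refl
∑-const (x ∷ xs) c = cong (c +_) (∑-const xs c)

∑-zero : ∀ xs {f : X → ℕ} → (∀ {x} → x ∈ xs → f x ≡ 0) → ∑ xs f ≡ 0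
∑-zero xs f≡0 = trans (∑-cong xs f≡0) (trans (∑-const xs 0) (*-zeroʳ (length xs)))

∑-swap : ∀ xs ys (f : X → Y → ℕ) → ∑ xs (λ x → ∑ ys (f x)) ≡ ∑ ys (λ y → ∑ xs (λ x → f x y))
∑-swap []       ys f = trans (sym (*-zeroʳ (length ys))) (sym (∑-const ys 0))
∑-swap (x ∷ xs) ys f = trans (cong (∑ ys (f x) +_) (∑-swap xs ys f)) (sym (∑-+ ys (f x) (λ y → ∑ xs (λ x → f x y))))

average⁺ : ∀ x xs (f : X → ℕ) {c} → ∑ (x ∷ xs) f ≤ length (x ∷ xs) * c → ∃[ y ] y ∈ x ∷ xs × f y ≤ c
average⁺ x [] f {c} ∑≤ = x , here refl , subst₂ _≤_ (+-identityʳ (f x)) (+-identityʳ c) ∑≤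
average⁺ x (x′ ∷ xs) f {c} ∑≤ with f x ≤? c
... | yes fx≤c = x , here refl , fx≤c
... | no fx≰c with average⁺ x′ xs f (+-cancelˡ-≤ c _ _ (≤-trans (+-monoˡ-≤ (∑ (x′ ∷ xs) f) (≰⇒≥ fx≰c)) ∑≤))
...   | y , y∈xs , fy≤c = y , there y∈xs , fy≤c

average : ∀ xs (f : X → ℕ) {c} → 0 < length xs → ∑ xs f ≤ length xs * c → ∃[ x ] x ∈ xs × f x ≤ c
average (x ∷ xs) f _ = average⁺ x xs f

-- Markov's inequality in counting form: each element kept contributes at least one to the sum.
length-filter-≤ : ∀ {P : X → Set} (P? : Decidable P) (h : X → ℕ) xs →
                  (∀ {x} → x ∈ xs → P x → 1 ≤ h x) → length (filter P? xs) ≤ ∑ xs h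
length-filter-≤ P? h [] _ = z≤n
length-filter-≤ P? h (x ∷ xs) P⇒h with P? x
... | yes p = +-mono-≤ (P⇒h (here refl) p) (length-filter-≤ P? h xs (P⇒h ∘ there))
... | no _  = ≤-trans (length-filter-≤ P? h xs (P⇒h ∘ there)) (m≤n+m _ (h x))

-- Drawing without replacement

-- The remaining list keeps its order, so two letters drawn in either order leave the same list.
picks : List X → List (X × List X)
picks []      = []
picks (x ∷ R) = (x , R) ∷ map (λ (a , R′) → a , x ∷ R′) (picks R)

∑-picks : ∀ x R (f : X × List X → ℕ) →
          ∑ (picks (x ∷ R)) f ≡ f (x , R) + ∑ (picks R) (λ (a , R′) → f (a , x ∷ R′))
∑-picks x R f = cong (f (x , R) +_) (∑-map _ (picks R) f)

picks-↭ : ∀ (R : List X) {p} → p ∈ picks R → R ↭ proj₁ p ∷ proj₂ p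
picks-↭ (x ∷ R) (here refl) = ↭-refl
picks-↭ (x ∷ R) (there p∈) with ∈.∈-map⁻ _ p∈
... | (a , R′) , p′∈ , refl = ↭-trans (↭-prep x (picks-↭ R p′∈)) (↭-swap x a ↭-refl)

length-rest : ∀ (R : List X) {p} → p ∈ picks R → length R ≡ suc (length (proj₂ p))
length-rest R p∈ = ↭.↭-length (picks-↭ R p∈)

length-picks : ∀ (R : List X) → length (picks R) ≡ length R
length-picks []      = refl
length-picks (x ∷ R) = cong suc (trans (List.length-map _ (picks R)) (length-picks R))

∑-picks-proj₁ : ∀ R (h : X → ℕ) → ∑ (picks R) (h ∘ proj₁) ≡ ∑ R h
∑-picks-proj₁ []      h = refl
∑-picks-proj₁ (x ∷ R) h = trans (∑-picks x R (h ∘ proj₁)) (cong (h x +_) (∑-picks-proj₁ R h))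

-- The ordered pairs split by whether `x` is drawn first, second or not at all. Swapping exchanges
-- the first two sums, and induction treats the third.
picks-swap : ∀ R (g : X → X → List X → ℕ) →
  ∑ (picks R) (λ (a , R′) → ∑ (picks R′) (λ (b , R″) → g a b R″)) ≡
  ∑ (picks R) (λ (a , R′) → ∑ (picks R′) (λ (b , R″) → g b a R″))
picks-swap [] g = refl
picks-swap (x ∷ R) g = begin
  ∑ (picks (x ∷ R)) (λ (a , R′) → ∑ (picks R′) (λ (b , R″) → g a b R″))
    ≡⟨ expand g ⟩
  ∑ (picks R) (λ (b , R″) → g x b R″) + (∑ (picks R) (λ (a , R′) → g a x R′) +
    ∑ (picks R) (λ (a , R′) → ∑ (picks R′) (λ (b , R″) → g a b (x ∷ R″))))
    ≡⟨ rotate (∑ (picks R) (λ (b , R″) → g x b R″)) (∑ (picks R) (λ (a , R′) → g a x R′)) _ ⟩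
  ∑ (picks R) (λ (a , R′) → g a x R′) + (∑ (picks R) (λ (b , R″) → g x b R″) +
    ∑ (picks R) (λ (a , R′) → ∑ (picks R′) (λ (b , R″) → g a b (x ∷ R″))))
    ≡⟨ cong (λ s → ∑ (picks R) (λ (a , R′) → g a x R′) + (∑ (picks R) (λ (b , R″) → g x b R″) + s))
         (picks-swap R (λ a b R″ → g a b (x ∷ R″))) ⟩
  ∑ (picks R) (λ (a , R′) → g a x R′) + (∑ (picks R) (λ (b , R″) → g x b R″) +
    ∑ (picks R) (λ (a , R′) → ∑ (picks R′) (λ (b , R″) → g b a (x ∷ R″))))
    ≡⟨ expand (λ a b → g b a) ⟨
  ∑ (picks (x ∷ R)) (λ (a , R′) → ∑ (picks R′) (λ (b , R″) → g b a R″)) ∎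
  where
  open ≡-Reasoning
  rotate : ∀ a b c → a + (b + c) ≡ b + (a + c)
  rotate = solve-∀
  expand : ∀ g → ∑ (picks (x ∷ R)) (λ (a , R′) → ∑ (picks R′) (λ (b , R″) → g a b R″)) ≡
    ∑ (picks R) (λ (b , R″) → g x b R″) + (∑ (picks R) (λ (a , R′) → g a x R′) +
      ∑ (picks R) (λ (a , R′) → ∑ (picks R′) (λ (b , R″) → g a b (x ∷ R″))))
  expand g = trans (∑-picks x R _) (cong (∑ (picks R) (λ (b , R″) → g x b R″) +_)
    (trans (∑-cong (picks R) (λ { {a , R′} _ → ∑-picks x R′ _ })) (∑-+ (picks R) _ _)))

draws : ℕ → List X → List (List X × List X)
draws zero    R = [ ([] , R) ]
draws (suc k) R = concatMap (λ (a , R′) → map (λ (B , R″) → a ∷ B , R″) (draws k R′)) (picks R)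

∑-draws : ∀ k R (f : List X × List X → ℕ) →
  ∑ (draws (suc k) R) f ≡ ∑ (picks R) (λ (a , R′) → ∑ (draws k R′) (λ (B , R″) → f (a ∷ B , R″)))
∑-draws k R f = trans (∑-concatMap _ (picks R) f) (∑-cong (picks R) (λ { {a , R′} _ → ∑-map _ (draws k R′) f }))

draws-↭ : ∀ k (R : List X) {p} → p ∈ draws k R → R ↭ proj₁ p ++ proj₂ p
draws-↭ zero    R (here refl) = ↭-refl
draws-↭ (suc k) R p∈ with find (∈.∈-concatMap⁻ _ {xs = picks R} p∈)
... | (a , R′) , a∈ , p∈′ with ∈.∈-map⁻ _ p∈′
...   | q , q∈ , refl = ↭-trans (picks-↭ R a∈) (↭-prep a (draws-↭ k R′ q∈))

length-undrawn : ∀ k (R : List X) {p} → p ∈ draws k R → length (proj₂ p) ≡ length R ∸ k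
length-undrawn zero    R (here refl) = refl
length-undrawn (suc k) R p∈ with find (∈.∈-concatMap⁻ _ {xs = picks R} p∈)
... | (a , R′) , a∈ , p∈′ with ∈.∈-map⁻ _ p∈′
...   | q , q∈ , refl = trans (length-undrawn k R′ q∈) (cong (_∸ suc k) (sym (length-rest R a∈)))

-- The falling factorial `m (m - 1) ... (m - k + 1)`. Once `pred` truncates at zero, the product
-- already contains the factor zero.
falling : ℕ → ℕ → ℕ
falling m zero    = 1
falling m (suc k) = m * falling (pred m) k

∑-draws-1 : ∀ k (R : List X) → ∑ (draws k R) (λ _ → 1) ≡ falling (length R) k
∑-draws-1 zero    R = refl
∑-draws-1 (suc k) R = begin
  ∑ (draws (suc k) R) (λ _ → 1)
    ≡⟨ ∑-draws k R _ ⟩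
  ∑ (picks R) (λ (_ , R′) → ∑ (draws k R′) (λ _ → 1))
    ≡⟨ ∑-cong (picks R) (λ { {_ , R′} a∈ → trans (∑-draws-1 k R′)
         (cong (λ m → falling (pred m) k) (sym (length-rest R a∈))) }) ⟩
  ∑ (picks R) (λ _ → falling (pred (length R)) k)
    ≡⟨ ∑-const (picks R) _ ⟩
  length (picks R) * falling (pred (length R)) k
    ≡⟨ cong (_* falling (pred (length R)) k) (length-picks R) ⟩
  length R * falling (pred (length R)) k ∎
  where open ≡-Reasoning

∑ᵈ : ℕ → List X → (List X → ℕ) → ℕ
∑ᵈ k R g = ∑ (draws k R) (g ∘ proj₁)

∑ᵈ-vanish : ∀ k R {g : List X → ℕ} → (∀ b B → g (b ∷ B) ≡ 0) → ∑ᵈ (suc k) R g ≡ 0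
∑ᵈ-vanish k R g≡0 = trans (∑-draws k R _)
  (∑-zero (picks R) λ { {b , R′} _ → ∑-zero (draws k R′) λ { {B , _} _ → g≡0 b B } })

-- Each k-sequence is drawn from R minus a letter for all letters it avoids.
picks-∑ᵈ : ∀ k R (g : List X → ℕ) → ∑ (picks R) (λ (_ , R′) → ∑ᵈ k R′ g) ≡ (length R ∸ k) * ∑ᵈ k R g
picks-∑ᵈ zero R g = trans (∑-const (picks R) _) (cong (_* (g [] + 0)) (length-picks R))
picks-∑ᵈ (suc k) R g = begin
  ∑ (picks R) (λ (_ , R′) → ∑ᵈ (suc k) R′ g)
    ≡⟨ ∑-cong (picks R) (λ { {_ , R′} _ → ∑-draws k R′ (g ∘ proj₁) }) ⟩
  ∑ (picks R) (λ (_ , R′) → ∑ (picks R′) (λ (b , R″) → ∑ᵈ k R″ (g ∘ (b ∷_))))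
    ≡⟨ picks-swap R (λ _ b R″ → ∑ᵈ k R″ (g ∘ (b ∷_))) ⟩
  ∑ (picks R) (λ (b , R′) → ∑ (picks R′) (λ (_ , R″) → ∑ᵈ k R″ (g ∘ (b ∷_))))
    ≡⟨ ∑-cong (picks R) (λ { {b , R′} b∈ → trans (picks-∑ᵈ k R′ (g ∘ (b ∷_)))
         (cong (λ m → (m ∸ suc k) * ∑ᵈ k R′ (g ∘ (b ∷_))) (sym (length-rest R b∈))) }) ⟩
  ∑ (picks R) (λ (b , R′) → (length R ∸ suc k) * ∑ᵈ k R′ (g ∘ (b ∷_)))
    ≡⟨ ∑-*ˡ (length R ∸ suc k) (picks R) _ ⟩
  (length R ∸ suc k) * ∑ (picks R) (λ (b , R′) → ∑ᵈ k R′ (g ∘ (b ∷_)))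
    ≡⟨ cong ((length R ∸ suc k) *_) (∑-draws k R (g ∘ proj₁)) ⟨
  (length R ∸ suc k) * ∑ᵈ (suc k) R g ∎
  where open ≡-Reasoning

-- Each `k`-sequence survives the removal of `j` letters exactly when these are drawn, in order,
-- from the `length R ∸ k` letters that it avoids.
draws-∑ᵈ : ∀ j k R (g : List X → ℕ) →
           ∑ (draws j R) (λ (_ , R′) → ∑ᵈ k R′ g) ≡ falling (length R ∸ k) j * ∑ᵈ k R g
draws-∑ᵈ zero    k R g = refl
draws-∑ᵈ (suc j) k R g = begin
  ∑ (draws (suc j) R) (λ (_ , R′) → ∑ᵈ k R′ g)
    ≡⟨ ∑-draws j R _ ⟩
  ∑ (picks R) (λ (_ , R′) → ∑ (draws j R′) (λ (_ , R″) → ∑ᵈ k R″ g))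
    ≡⟨ ∑-cong (picks R) (λ { {_ , R′} a∈ → trans (draws-∑ᵈ j k R′ g)
         (cong (λ m → falling m j * ∑ᵈ k R′ g) (trans
           (cong (_∸ suc k) (sym (length-rest R a∈))) (sym (pred[m∸n]≡m∸[1+n] (length R) k)))) }) ⟩
  ∑ (picks R) (λ (_ , R′) → falling (pred (length R ∸ k)) j * ∑ᵈ k R′ g)
    ≡⟨ ∑-*ˡ (falling (pred (length R ∸ k)) j) (picks R) _ ⟩
  falling (pred (length R ∸ k)) j * ∑ (picks R) (λ (_ , R′) → ∑ᵈ k R′ g)
    ≡⟨ cong (falling (pred (length R ∸ k)) j *_) (picks-∑ᵈ k R g) ⟩
  falling (pred (length R ∸ k)) j * ((length R ∸ k) * ∑ᵈ k R g)
    ≡⟨ rotate (falling (pred (length R ∸ k)) j) (length R ∸ k) (∑ᵈ k R g) ⟩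
  falling (length R ∸ k) (suc j) * ∑ᵈ k R g ∎
  where
  open ≡-Reasoning
  rotate : ∀ a b c → a * (b * c) ≡ b * a * c
  rotate = solve-∀

-- Sequences of disjoint blocks of equal length

module Blocks (k : ℕ) where

  blocks : ℕ → List X → List (List (List X))
  blocks zero    R = [ [] ]
  blocks (suc q) R = concatMap (λ (B , R′) → map (B ∷_) (blocks q R′)) (draws k R)

  ∑-blocks : ∀ q R (f : List (List X) → ℕ) →
    ∑ (blocks (suc q) R) f ≡ ∑ (draws k R) (λ (B , R′) → ∑ (blocks q R′) (f ∘ (B ∷_)))
  ∑-blocks q R f = trans (∑-concatMap _ (draws k R) f)
    (∑-cong (draws k R) (λ { {B , R′} _ → ∑-map (B ∷_) (blocks q R′) f }))

  blocks-↭ : ∀ q (R : List X) {Bs} → Bs ∈ blocks q R → ∃[ R′ ] R ↭ concat Bs ++ R′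
  blocks-↭ zero    R (here refl) = R , ↭-refl
  blocks-↭ (suc q) R Bs∈ with find (∈.∈-concatMap⁻ _ {xs = draws k R} Bs∈)
  ... | (B , R′) , B∈ , Bs∈′ with ∈.∈-map⁻ _ Bs∈′
  ...   | Bs′ , Bs′∈ , refl with blocks-↭ q R′ Bs′∈
  ...     | R″ , R′↭ = R″ , ↭-trans (draws-↭ k R B∈) (↭-trans (↭.++⁺ˡ B R′↭)
    (↭-reflexive (sym (List.++-assoc B (concat Bs′) R″))))

  length-blocks : ∀ q (R : List X) {Bs} → Bs ∈ blocks q R → length Bs ≡ q
  length-blocks zero    R (here refl) = refl
  length-blocks (suc q) R Bs∈ with find (∈.∈-concatMap⁻ _ {xs = draws k R} Bs∈)
  ... | (B , R′) , B∈ , Bs∈′ with ∈.∈-map⁻ _ Bs∈′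
  ...   | Bs′ , Bs′∈ , refl = cong suc (length-blocks q R′ Bs′∈)

  -- The falling factorial `falling m (q * k)`, taken one block at a time to match the recursion of
  -- `blocks`.
  blockCount : ℕ → ℕ → ℕ
  blockCount zero    m = 1
  blockCount (suc q) m = falling m k * blockCount q (m ∸ k)

  ∑-blocks-const : ∀ q (R : List X) c → ∑ (blocks q R) (λ _ → c) ≡ c * blockCount q (length R)
  ∑-blocks-const zero    R c = trans (+-identityʳ c) (sym (*-identityʳ c))
  ∑-blocks-const (suc q) R c = begin
    ∑ (blocks (suc q) R) (λ _ → c)
      ≡⟨ ∑-blocks q R _ ⟩
    ∑ (draws k R) (λ (_ , R′) → ∑ (blocks q R′) (λ _ → c))
      ≡⟨ ∑-cong (draws k R) (λ { {_ , R′} B∈ → trans (∑-blocks-const q R′ c)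
           (trans (cong (λ m → c * blockCount q m) (length-undrawn k R B∈)) (sym (*-identityʳ _))) }) ⟩
    ∑ (draws k R) (λ _ → c * blockCount q (length R ∸ k) * 1)
      ≡⟨ ∑-*ˡ (c * blockCount q (length R ∸ k)) (draws k R) _ ⟩
    c * blockCount q (length R ∸ k) * ∑ (draws k R) (λ _ → 1)
      ≡⟨ cong (c * blockCount q (length R ∸ k) *_) (∑-draws-1 k R) ⟩
    c * blockCount q (length R ∸ k) * falling (length R) k
      ≡⟨ rotate c (blockCount q (length R ∸ k)) (falling (length R) k) ⟩
    c * blockCount (suc q) (length R) ∎
    where
    open ≡-Reasoning
    rotate : ∀ a b c → a * b * c ≡ a * (c * b)
    rotate = solve-∀

  -- All q + 1 blocks are equidistributed.
  ∑-blocks-∑ : ∀ q R (g : List X → ℕ) →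
    ∑ (blocks (suc q) R) (λ Bs → ∑ Bs g) ≡ suc q * (∑ᵈ k R g * blockCount q (length R ∸ k))
  ∑-blocks-∑ q R g = begin
    ∑ (blocks (suc q) R) (λ Bs → ∑ Bs g)
      ≡⟨ ∑-blocks q R _ ⟩
    ∑ (draws k R) (λ (B , R′) → ∑ (blocks q R′) (λ Bs → g B + ∑ Bs g))
      ≡⟨ ∑-cong (draws k R) (λ { {B , R′} B∈ → trans (∑-+ (blocks q R′) _ _)
           (cong (_+ ∑ (blocks q R′) (λ Bs → ∑ Bs g)) (trans (∑-blocks-const q R′ (g B))
             (cong (λ m → g B * blockCount q m) (length-undrawn k R B∈)))) }) ⟩
    ∑ (draws k R) (λ (B , R′) → g B * c + ∑ (blocks q R′) (λ Bs → ∑ Bs g))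
      ≡⟨ ∑-+ (draws k R) _ _ ⟩
    ∑ (draws k R) (λ (B , _) → g B * c) + ∑ (draws k R) (λ (_ , R′) → ∑ (blocks q R′) (λ Bs → ∑ Bs g))
      ≡⟨ cong₂ _+_ (∑-*ʳ c (draws k R) (g ∘ proj₁)) (rest q) ⟩
    suc q * (∑ᵈ k R g * c) ∎
    where
    open ≡-Reasoning
    c = blockCount q (length R ∸ k)
    rotate : ∀ q x f b → q * b * (f * x) ≡ q * (x * (f * b))
    rotate = solve-∀
    rotate′ : ∀ q x b → q * (x * b) ≡ q * b * x
    rotate′ = solve-∀
    -- The later blocks are covered by the lemma itself, applied to what the first block leaves
    -- over; `draws-∑ᵈ` then sums over all choices of that first block.
    rest : ∀ q → ∑ (draws k R) (λ (_ , R′) → ∑ (blocks q R′) (λ Bs → ∑ Bs g)) ≡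
           q * (∑ᵈ k R g * blockCount q (length R ∸ k))
    rest zero = ∑-zero (draws k R) (λ _ → refl)
    rest (suc q) = begin
      ∑ (draws k R) (λ (_ , R′) → ∑ (blocks (suc q) R′) (λ Bs → ∑ Bs g))
        ≡⟨ ∑-cong (draws k R) (λ { {_ , R′} B∈ → trans (∑-blocks-∑ q R′ g)
             (trans (cong (λ m → suc q * (∑ᵈ k R′ g * blockCount q (m ∸ k))) (length-undrawn k R B∈))
               (rotate′ (suc q) (∑ᵈ k R′ g) _)) }) ⟩
      ∑ (draws k R) (λ (_ , R′) → suc q * blockCount q (length R ∸ k ∸ k) * ∑ᵈ k R′ g)
        ≡⟨ ∑-*ˡ (suc q * blockCount q (length R ∸ k ∸ k)) (draws k R) _ ⟩
      suc q * blockCount q (length R ∸ k ∸ k) * ∑ (draws k R) (λ (_ , R′) → ∑ᵈ k R′ g)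
        ≡⟨ cong (suc q * blockCount q (length R ∸ k ∸ k) *_) (draws-∑ᵈ k k R g) ⟩
      suc q * blockCount q (length R ∸ k ∸ k) * (falling (length R ∸ k) k * ∑ᵈ k R g)
        ≡⟨ rotate (suc q) (∑ᵈ k R g) (falling (length R ∸ k) k) _ ⟩
      suc q * (∑ᵈ k R g * blockCount (suc q) (length R ∸ k)) ∎

-- Sequences occurring in short windows

⊆-split : ∀ (u : List X) {v w} → u ++ v ⊆ w → ∃₂ λ w₁ w₂ → w ≡ w₁ ++ w₂ × u ⊆ w₁ × v ⊆ w₂
⊆-split []      {w = w} v⊆w = [] , w , refl , [] , v⊆w
⊆-split (x ∷ u) (y ∷ʳ uv⊆w) with ⊆-split (x ∷ u) uv⊆w
... | w₁ , w₂ , refl , u⊆ , v⊆ = y ∷ w₁ , w₂ , refl , y ∷ʳ u⊆ , v⊆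
⊆-split (x ∷ u) (x≡ ∷ uv⊆w) with ⊆-split u uv⊆w
... | w₁ , w₂ , refl , u⊆ , v⊆ = _ ∷ w₁ , w₂ , refl , x≡ ∷ u⊆ , v⊆

module Windows {A : Set} (_≟_ : DecidableEquality A) where

  open DecSublist _≟_ using (_⊆?_)

  -- The number of occurrences of `B` as a subsequence of the first `s` letters of `v`. Counting
  -- occurrences rather than testing for one gives a recursion like Pascal's rule.
  embeds : ℕ → List A → List A → ℕ
  embeds s       []      v       = 1
  embeds zero    (b ∷ B) v       = 0
  embeds (suc s) (b ∷ B) []      = 0
  embeds (suc s) (b ∷ B) (x ∷ v) = (if does (b ≟ x) then embeds s B v else 0) + embeds s (b ∷ B) v

  embeds-⊆ : ∀ {s B v} u → B ⊆ v → length v ≤ s → 1 ≤ embeds s B (v ++ u)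
  embeds-⊆ u [] _ = ≤-refl
  embeds-⊆ {B = []} u (x ∷ʳ B⊆v) _ = ≤-refl
  embeds-⊆ {B = _ ∷ _} u (x ∷ʳ B⊆v) (s≤s v≤s) = ≤-trans (embeds-⊆ u B⊆v v≤s) (m≤n+m _ _)
  embeds-⊆ {B = b ∷ _} u (refl ∷ B⊆v) (s≤s v≤s) with b ≟ b
  ... | yes _  = ≤-trans (embeds-⊆ u B⊆v v≤s) (m≤m+n _ _)
  ... | no b≢b = contradiction refl b≢b

  -- Occurrences summed over the windows of at most `s` letters starting at each of the
  -- `length w + 1` positions, the end of the word included.
  windows : ℕ → List A → List A → ℕ
  windows s B []      = embeds s B []
  windows s B (x ∷ w) = embeds s B (x ∷ w) + windows s B w

  windows-⊆ : ∀ {s B v} u → B ⊆ v → length v ≤ s → 1 ≤ windows s B (v ++ u)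
  windows-⊆ {s} {B} {v} u B⊆v v≤s = ≤-trans (embeds-⊆ u B⊆v v≤s) (first (v ++ u))
    where
    first : ∀ w → embeds s B w ≤ windows s B w
    first []      = ≤-refl
    first (x ∷ w) = m≤m+n _ _

  windows-++ : ∀ s B u v → windows s B v ≤ windows s B (u ++ v)
  windows-++ s B []      v = ≤-refl
  windows-++ s B (x ∷ u) v = ≤-trans (windows-++ s B u v) (m≤n+m _ _)

  -- The word is cut into consecutive stretches, each containing one block, the last extending to
  -- the end. A stretch of at most `s` letters gives a hit. A longer one is discarded and uses up
  -- `s` letters of the budget; with no block left, the length bound is absurd.
  some-block-short : ∀ s Bs w → concat Bs ⊆ w → length w < length Bs * s → 1 ≤ ∑ Bs (λ B → windows s B w)
  some-block-short s (B ∷ Bs) w Bs⊆w short with ⊆-split B Bs⊆w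
  ... | w₁ , w₂ , refl , B⊆w₁ , Bs⊆w₂ with length w₁ ≤? s
  ...   | yes w₁≤s = ≤-trans (windows-⊆ w₂ B⊆w₁ w₁≤s) (m≤m+n _ _)
  ...   | no w₁≰s  = ≤-trans (some-block-short s Bs w₂ Bs⊆w₂ w₂-short)
    (≤-trans (∑-mono Bs (λ {B′} _ → windows-++ s B′ w₁ w₂)) (m≤n+m _ (windows s B (w₁ ++ w₂))))
    where
    w₂-short : length w₂ < length Bs * s
    w₂-short = +-cancelˡ-< s _ _ (≤-<-trans (+-monoˡ-≤ (length w₂) (≰⇒≥ w₁≰s))
      (subst (_< s + length Bs * s) (List.length-++ w₁) short))

  ∑-unique : ∀ {R} x c → Unique R → ∑ R (λ b → if does (b ≟ x) then c else 0) ≤ c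
  ∑-unique x c [] = z≤n
  ∑-unique {b ∷ R} x c (b∉R ∷ unique) with b ≟ x
  ... | no _     = ∑-unique x c unique
  ... | yes refl = ≤-reflexive (trans (cong (c +_) rest≡0) (+-identityʳ c))
    where
    vanish : ∀ {y} → b ≢ y → (if does (y ≟ b) then c else 0) ≡ 0
    vanish {y} b≢y with y ≟ b
    ... | yes y≡b = contradiction (sym y≡b) b≢y
    ... | no _    = refl
    rest≡0 : ∑ R (λ y → if does (y ≟ b) then c else 0) ≡ 0
    rest≡0 = ∑-zero R (λ y∈R → vanish (All.lookup b∉R y∈R))

  Unique-↭ : ∀ {R R′ : List A} → R ↭ R′ → Unique R → Unique R′
  Unique-↭ R↭R′ = ↭ₛ.Unique-resp-↭ (setoid A) (↭⇒↭ₛ R↭R′)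

  -- There are at most (s choose k) ≤ (r + 1)^s r^k / r^s subsequences of length k in s letters.
  ∑ᵈ-embeds : ∀ r s k v {R} → Unique R →
    ∑ᵈ k R (λ B → embeds s B v) * r ^ s ≤ suc r ^ s * r ^ k
  ∑ᵈ-embeds r s zero v unique = subst₂ _≤_ (sym (+-identityʳ (r ^ s))) (sym (*-identityʳ (suc r ^ s)))
    (^-monoˡ-≤ s (n≤1+n r))
  ∑ᵈ-embeds r zero (suc k) v {R} unique = subst (_≤ 1 * r ^ suc k) (sym (cong (_* 1) (∑ᵈ-vanish k R (λ _ _ → refl)))) z≤n
  ∑ᵈ-embeds r (suc s) (suc k) [] {R} unique = subst (_≤ suc r ^ suc s * r ^ suc k) 
    (sym (cong (_* r ^ suc s) (∑ᵈ-vanish k R (λ _ _ → refl)))) z≤n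
  ∑ᵈ-embeds r (suc s) (suc k) (x ∷ v) {R} unique = begin
    ∑ᵈ (suc k) R (λ B → embeds (suc s) B (x ∷ v)) * (r * r ^ s)
      ≡⟨ cong (_* (r * r ^ s)) expand ⟩
    (∑ (picks R) first + ∑ᵈ (suc k) R (λ B → embeds s B v)) * (r * r ^ s)
      ≡⟨ distribute (∑ (picks R) first) (∑ᵈ (suc k) R (λ B → embeds s B v)) r (r ^ s) ⟩
    r * (∑ (picks R) first * r ^ s + ∑ᵈ (suc k) R (λ B → embeds s B v) * r ^ s)
      -- Whether `x` is used or skipped, `s` letters of the window remain, and `r` times the sum of
      -- the two inductive bounds is exactly the bound for `suc s`.
      ≤⟨ *-monoʳ-≤ r (+-mono-≤ first≤ (∑ᵈ-embeds r s (suc k) v unique)) ⟩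
    r * (suc r ^ s * r ^ k + suc r ^ s * (r * r ^ k))
      ≡⟨ collect r (suc r ^ s) (r ^ k) ⟩
    suc r * suc r ^ s * (r * r ^ k) ∎
    where
    open ≤-Reasoning
    distribute : ∀ a b r p → (a + b) * (r * p) ≡ r * (a * p + b * p)
    distribute = solve-∀
    collect : ∀ r p t → r * (p * t + p * (r * t)) ≡ (p + r * p) * (r * t)
    collect = solve-∀
    first : A × List A → ℕ
    first (b , R′) = if does (b ≟ x) then ∑ᵈ k R′ (λ B → embeds s B v) else 0
    pull-if : ∀ (c : Bool) R′ → ∑ᵈ k R′ (λ B → if c then embeds s B v else 0) ≡
              (if c then ∑ᵈ k R′ (λ B → embeds s B v) else 0)
    pull-if true  R′ = refl
    pull-if false R′ = ∑-zero (draws k R′) (λ _ → refl)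
    expand : ∑ᵈ (suc k) R (λ B → embeds (suc s) B (x ∷ v)) ≡
             ∑ (picks R) first + ∑ᵈ (suc k) R (λ B → embeds s B v)
    expand = trans (∑-draws k R _) (trans
      (∑-cong (picks R) (λ { {b , R′} _ → trans (∑-+ (draws k R′) _ _)
        (cong (_+ ∑ᵈ k R′ (λ B → embeds s (b ∷ B) v)) (pull-if (does (b ≟ x)) R′)) }))
      (trans (∑-+ (picks R) first _) (cong (∑ (picks R) first +_) (sym (∑-draws k R _)))))
    bound = suc r ^ s * r ^ k
    first-bound : ∀ {p} → p ∈ picks R → first p * r ^ s ≤ (if does (proj₁ p ≟ x) then bound else 0)
    first-bound {b , R′} b∈ with does (b ≟ x)
    ... | false = z≤n
    ... | true with Unique-↭ (picks-↭ R b∈) unique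
    ...   | _ ∷ unique′ = ∑ᵈ-embeds r s k v unique′
    -- As `R` repeats no letter, at most one pick equals `x`, so the choice of the first letter
    -- costs no factor `length R`.
    first≤ : ∑ (picks R) first * r ^ s ≤ bound
    first≤ = begin
      ∑ (picks R) first * r ^ s                                             ≡⟨ ∑-*ʳ (r ^ s) (picks R) first ⟨
      ∑ (picks R) (λ p → first p * r ^ s)                                   ≤⟨ ∑-mono (picks R) first-bound ⟩
      ∑ (picks R) (λ p → if does (proj₁ p ≟ x) then bound else 0)           ≡⟨ ∑-picks-proj₁ R _ ⟩
      ∑ R (λ b → if does (b ≟ x) then bound else 0)                         ≤⟨ ∑-unique x bound unique ⟩
      bound                                                                 ∎

  ∑ᵈ-windows : ∀ r s k w {R} → Unique R →
    ∑ᵈ k R (λ B → windows s B w) * r ^ s ≤ suc (length w) * (suc r ^ s * r ^ k)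
  ∑ᵈ-windows r s k [] unique = ≤-trans (∑ᵈ-embeds r s k [] unique) (≤-reflexive (sym (+-identityʳ _)))
  ∑ᵈ-windows r s k (x ∷ w) {R} unique = begin
    ∑ᵈ k R (λ B → embeds s B (x ∷ w) + windows s B w) * r ^ s
      ≡⟨ cong (_* r ^ s) (∑-+ (draws k R) _ _) ⟩
    (∑ᵈ k R (λ B → embeds s B (x ∷ w)) + ∑ᵈ k R (λ B → windows s B w)) * r ^ s
      ≡⟨ *-distribʳ-+ (r ^ s) (∑ᵈ k R (λ B → embeds s B (x ∷ w))) _ ⟩
    ∑ᵈ k R (λ B → embeds s B (x ∷ w)) * r ^ s + ∑ᵈ k R (λ B → windows s B w) * r ^ s
      ≤⟨ +-mono-≤ (∑ᵈ-embeds r s k (x ∷ w) unique) (∑ᵈ-windows r s k w unique) ⟩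
    suc (length (x ∷ w)) * (suc r ^ s * r ^ k) ∎
    where open ≤-Reasoning

  module _ (k q : ℕ) {R : List A} (unique : Unique R) where
    open Blocks k

    -- First moment method: by `few`, a short word receives at most half a hit on average over the
    -- block sequences. Exchanging the two sums and averaging yields one sequence that is contained
    -- in at most half of `W`.
    halving : ∀ r s .{{_ : NonZero r}} → 0 < blockCount (suc q) (length R) →
      2 * suc q * (suc q * s) * (suc r ^ s * r ^ k) ≤ r ^ s * falling (length R) k →
      ∀ W → All (λ w → length w < suc q * s) W →
      ∃[ Bs ] Bs ∈ blocks (suc q) R × 2 * length (filter (concat Bs ⊆?_) W) ≤ length W
    halving r s nonempty few W short = average (blocks (suc q) R) survivors
      (subst (0 <_) (sym count) nonempty) (begin
      ∑ (blocks (suc q) R) survivors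
        ≤⟨ ∑-mono (blocks (suc q) R) (λ {Bs} Bs∈ → *-monoʳ-≤ 2 (length-filter-≤ (concat Bs ⊆?_) (hits Bs) W
             (λ {w} w∈ Bs⊆w → some-block-short s Bs w Bs⊆w
               (subst (λ l → length w < l * s) (sym (length-blocks (suc q) R Bs∈)) (All.lookup short w∈))))) ⟩
      ∑ (blocks (suc q) R) (λ Bs → 2 * ∑ W (hits Bs))
        ≡⟨ ∑-*ˡ 2 (blocks (suc q) R) _ ⟩
      2 * ∑ (blocks (suc q) R) (λ Bs → ∑ W (hits Bs))
        ≡⟨ cong (2 *_) (∑-swap (blocks (suc q) R) W hits) ⟩
      2 * ∑ W (λ w → ∑ (blocks (suc q) R) (λ Bs → hits Bs w))
        ≡⟨ ∑-*ˡ 2 W _ ⟨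
      ∑ W (λ w → 2 * ∑ (blocks (suc q) R) (λ Bs → hits Bs w))
        ≤⟨ ∑-mono W (λ {w} w∈ → rare w (All.lookup short w∈)) ⟩
      ∑ W (λ _ → blockCount (suc q) (length R))
        ≡⟨ ∑-const W _ ⟩
      length W * blockCount (suc q) (length R)
        ≡⟨ *-comm (length W) _ ⟩
      blockCount (suc q) (length R) * length W
        ≡⟨ cong (_* length W) count ⟨
      length (blocks (suc q) R) * length W ∎)
      where
      open ≤-Reasoning
      hits : List (List A) → List A → ℕ
      hits Bs w = ∑ Bs (λ B → windows s B w)
      survivors : List (List A) → ℕ
      survivors Bs = 2 * length (filter (concat Bs ⊆?_) W)
      count : length (blocks (suc q) R) ≡ blockCount (suc q) (length R)
      count = trans (sym (trans (∑-const (blocks (suc q) R) 1) (*-identityʳ _)))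
        (trans (∑-blocks-const (suc q) R 1) (+-identityʳ _))
      rare : ∀ w → length w < suc q * s →
             2 * ∑ (blocks (suc q) R) (λ Bs → hits Bs w) ≤ blockCount (suc q) (length R)
      rare w w-short = begin
        2 * ∑ (blocks (suc q) R) (λ Bs → hits Bs w)
          ≡⟨ cong (2 *_) (∑-blocks-∑ q R (λ B → windows s B w)) ⟩
        2 * (suc q * (x * b))
          ≡⟨ assoc (suc q) x b ⟩
        2 * suc q * x * b
          -- The factor `r ^ s` clears the denominator of the bound `(1 + 1/r) ^ s * r ^ k` for one
          -- window.
          ≤⟨ *-monoˡ-≤ b (*-cancelˡ-≤ (r ^ s) {{m^n≢0 r s}} (begin
               r ^ s * (2 * suc q * x)                        ≡⟨ rotate (r ^ s) (2 * suc q) x ⟩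
               2 * suc q * (x * r ^ s)                        ≤⟨ *-monoʳ-≤ (2 * suc q) (∑ᵈ-windows r s k w unique) ⟩
               -- The strict bound on the length of `w` accounts for the additional window at its
               -- end.
               2 * suc q * (suc (length w) * y)               ≤⟨ *-monoʳ-≤ (2 * suc q) (*-monoˡ-≤ y w-short) ⟩
               2 * suc q * (suc q * s * y)                    ≡⟨ *-assoc (2 * suc q) (suc q * s) y ⟨
               2 * suc q * (suc q * s) * y                    ≤⟨ few ⟩
               r ^ s * falling (length R) k                   ∎)) ⟩
        falling (length R) k * b ∎
        where
        x = ∑ᵈ k R (λ B → windows s B w)
        y = suc r ^ s * r ^ k
        b = blockCount q (length R ∸ k)
        assoc : ∀ p x b → 2 * (p * (x * b)) ≡ 2 * p * x * b
        assoc = solve-∀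
        rotate : ∀ a b c → a * (b * c) ≡ b * (c * a)
        rotate = solve-∀

-- Sequences excluding all short words

falling-≥ : ∀ m k → m ^ k ≤ falling (k + m) k
falling-≥ m zero    = ≤-refl
falling-≥ m (suc k) = *-mono-≤ (m≤n+m m (suc k)) (falling-≥ m k)

falling-pos : ∀ m k → 0 < falling (k + m) k
falling-pos m zero    = z<s
falling-pos m (suc k) = *-mono-≤ (s≤s (z≤n {k + m})) (falling-pos m k)

blockCount-pos : ∀ k q → 0 < Blocks.blockCount k q (q * k)
blockCount-pos k zero    = z<s
blockCount-pos k (suc q) = *-mono-≤ (falling-pos (q * k) k)
  (subst (λ m → 0 < Blocks.blockCount k q m) (sym (m+n∸m≡n k (q * k))) (blockCount-pos k q))

wordsBelow : ∀ n → ℕ → List (Word n)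
wordsBelow n zero    = []
wordsBelow n (suc L) = [] ∷ concatMap (λ i → map (i ∷_) (wordsBelow n L)) (allFin n)

wordsBelow-short : ∀ n L → All (λ w → length w < L) (wordsBelow n L)
wordsBelow-short n zero    = []
wordsBelow-short n (suc L) = z<s ∷ All.concat⁺ (All.map⁺ (All.universal
  (λ i → All.map⁺ (All.map s≤s (wordsBelow-short n L))) (allFin n)))

∈-wordsBelow : ∀ {n L} (w : Word n) → length w < L → w ∈ wordsBelow n L
∈-wordsBelow []      (s≤s _)     = here refl
∈-wordsBelow (i ∷ w) (s≤s short) = there (∈.∈-concatMap⁺ _
  (lose (∈.∈-allFin i) (∈.∈-map⁺ (i ∷_) (∈-wordsBelow w short))))

length-wordsBelow : ∀ n L → length (wordsBelow n L) ≤ suc n ^ L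
length-wordsBelow n zero    = z≤n
length-wordsBelow n (suc L) = begin
  suc (length (concatMap extend (allFin n)))                ≡⟨ cong suc (length≡∑1 (concatMap extend (allFin n))) ⟩
  suc (∑ (concatMap extend (allFin n)) (λ _ → 1))           ≡⟨ cong suc (∑-concatMap extend (allFin n) (λ _ → 1)) ⟩
  suc (∑ (allFin n) (λ i → ∑ (extend i) (λ _ → 1)))         ≡⟨ cong suc (∑-cong (allFin n) λ {i} _ →
                                                                 trans (sym (length≡∑1 (extend i))) (List.length-map (i ∷_) (wordsBelow n L))) ⟩
  suc (∑ (allFin n) (λ i → length (wordsBelow n L)))        ≡⟨ cong suc (∑-const (allFin n) (length (wordsBelow n L))) ⟩
  suc (length (allFin n) * length (wordsBelow n L))         ≡⟨ cong (λ l → suc (l * length (wordsBelow n L))) (List.length-tabulate {n = n} id) ⟩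
  suc (n * length (wordsBelow n L))                         ≤⟨ +-mono-≤ (m^n>0 (suc n) L) (*-monoʳ-≤ n (length-wordsBelow n L)) ⟩
  suc n ^ suc L                                             ∎
  where
  open ≤-Reasoning
  extend : Fin n → List (Word n)
  extend i = map (i ∷_) (wordsBelow n L)
  length≡∑1 : ∀ (ws : List (Word n)) → length ws ≡ ∑ ws (λ _ → 1)
  length≡∑1 ws = sym (trans (∑-const ws 1) (*-identityʳ (length ws)))

-- Iterated halving over the selector states

module _ {S : X → Y → Set} (S? : ∀ x → Decidable (S x)) {P : Y → Set} {xs : List X}
  (halve : ∀ W → All P W → ∃[ x ] x ∈ xs × 2 * length (filter (S? x) W) ≤ length W) where

  -- Each of the `2 ^ t` selector states gets a choice that halves the words still alive. The states
  -- beginning with `false` come first; those beginning with `true` then act on the survivors.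
  family : ∀ t W → All P W → Σ[ G ∈ (State t → X) ] (∀ y → G y ∈ xs) × ∃[ W′ ] All P W′ ×
           2 ^ (2 ^ t) * length W′ ≤ length W × (∀ {w} → w ∈ W → (∀ y → S (G y) w) → w ∈ W′)
  family zero W PW with halve W PW
  ... | x , x∈ , halved = (λ _ → x) , (λ _ → x∈) , filter (S? x) W , All.filter⁺ (S? x) PW , halved ,
    λ w∈ Sw → ∈.∈-filter⁺ (S? x) w∈ (Sw [])
  family (suc t) W PW with family t W PW
  ... | G₀ , G₀∈ , W₁ , PW₁ , ≤W , survive₀ with family t W₁ PW₁
  ...   | G₁ , G₁∈ , W₂ , PW₂ , ≤W₁ , survive₁ = G , G∈ , W₂ , PW₂ , (begin
      2 ^ (2 * 2 ^ t) * length W₂               ≡⟨ cong (λ m → 2 ^ m * length W₂) (double (2 ^ t)) ⟩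
      2 ^ (2 ^ t + 2 ^ t) * length W₂           ≡⟨ cong (_* length W₂) (^-distribˡ-+-* 2 (2 ^ t) (2 ^ t)) ⟩
      2 ^ (2 ^ t) * 2 ^ (2 ^ t) * length W₂     ≡⟨ *-assoc (2 ^ (2 ^ t)) _ _ ⟩
      2 ^ (2 ^ t) * (2 ^ (2 ^ t) * length W₂)   ≤⟨ *-monoʳ-≤ (2 ^ (2 ^ t)) ≤W₁ ⟩
      2 ^ (2 ^ t) * length W₁                   ≤⟨ ≤W ⟩
      length W                                  ∎) ,
      λ w∈ Sw → survive₁ (survive₀ w∈ (Sw ∘ (false ∷_))) (Sw ∘ (true ∷_))
    where
    open ≤-Reasoning
    double : ∀ a → 2 * a ≡ a + a
    double = solve-∀
    G : State (suc t) → X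
    G (false ∷ y) = G₀ y
    G (true ∷ y)  = G₁ y
    G∈ : ∀ y → G y ∈ xs
    G∈ (false ∷ y) = G₀∈ y
    G∈ (true ∷ y)  = G₁∈ y

  -- A single survivor would require at least `2 ^ (2 ^ t)` words at the start.
  exhausting-family : ∀ t W → All P W → length W < 2 ^ (2 ^ t) →
    Σ[ G ∈ (State t → X) ] (∀ y → G y ∈ xs) × (∀ {w} → w ∈ W → ¬ (∀ y → S (G y) w))
  exhausting-family t W PW few with family t W PW
  ... | G , G∈ , []     , _ , _ , survive = G , G∈ , λ w∈ Sw → contradiction (survive w∈ Sw) λ ()
  ... | G , G∈ , _ ∷ W′ , _ , ≤W , _ =
    contradiction (≤-trans (m≤m*n (2 ^ (2 ^ t)) (suc (length W′))) ≤W) (<⇒≱ few)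

Unique-++⁻ˡ : ∀ (xs : List X) {ys} → Unique (xs ++ ys) → Unique xs
Unique-++⁻ˡ []       _               = []
Unique-++⁻ˡ (x ∷ xs) (x∉ ∷ unique) = All.++⁻ˡ xs x∉ ∷ Unique-++⁻ˡ xs unique

-- The network for given parameters

module _ (q k t : ℕ) where

  private
    N n : ℕ
    N = suc q * k
    n = N + t

    letters : List (Fin n)
    letters = map (_↑ˡ t) (allFin N)

    letters-unique : Unique letters
    letters-unique = Unique.map⁺ (Fin.↑ˡ-injective t _ _) (Unique.allFin⁺ N)

    length-letters : length letters ≡ N
    length-letters = trans (List.length-map _ (allFin N)) (List.length-tabulate {n = N} id)

    nonempty : 0 < Blocks.blockCount k (suc q) (length letters)
    nonempty = subst (λ m → 0 < Blocks.blockCount k (suc q) m) (sym length-letters) (blockCount-pos k (suc q))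

    Separating : ℕ → Set
    Separating L = Σ[ Bs ∈ (State t → List (List (Fin n))) ] (∀ y → Bs y ∈ Blocks.blocks k (suc q) letters) ×
      (∀ {w} → w ∈ wordsBelow n L → ¬ (∀ y → concat (Bs y) ⊆ w))

    follow-separating : ∀ L → Separating L →
                        ∃[ f ] Increasing {n} f × (∀ w → Fixes w f → L ≤ length w)
    follow-separating L (Bs , Bs∈ , separating) = follow σ , follow-increasing σ , slow
      where
      σ : State t → List (Fin n)
      σ y = concat (Bs y)
      -- Each sequence is an initial part of a rearrangement of `letters`, from which it inherits
      -- that its letters are distinct and low.
      rearranged : ∀ y → ∃[ R ] letters ↭ σ y ++ R
      rearranged y = Blocks.blocks-↭ k (suc q) letters (Bs∈ y)
      σ-unique : ∀ y → Unique (σ y)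
      σ-unique y = Unique-++⁻ˡ (σ y) (Windows.Unique-↭ Fin._≟_ (proj₂ (rearranged y)) letters-unique)
      σ-low : ∀ y → All Low (σ y)
      σ-low y = All.++⁻ˡ (σ y) (↭.All-resp-↭ (proj₂ (rearranged y))
        (All.map⁺ (All.universal (λ j → j , refl) (allFin N))))
      slow : ∀ w → Fixes w (follow σ) → L ≤ length w
      slow w fixes = ≮⇒≥ λ short → separating (∈-wordsBelow w short) (fixes⇒⊆ σ σ-unique σ-low w fixes)

  -- The first inequality allows halving any list of short words; the second says that the `2 ^ t`
  -- halvings outnumber the binary logarithm of the number of short words.
  slow-network : ∀ r s .{{_ : NonZero r}} →
    2 * suc q * (suc q * s) * (suc r ^ s * r ^ k) ≤ r ^ s * falling N k →
    suc n ^ (suc q * s) < 2 ^ (2 ^ t) →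
    ∃[ f ] Increasing {n} f × (∀ w → Fixes w f → suc q * s ≤ length w)
  slow-network r s few many = follow-separating L
    (exhausting-family (λ Bs → DecSublist._⊆?_ Fin._≟_ (concat Bs))
      (Windows.halving Fin._≟_ k q letters-unique r s nonempty
        (subst (λ m → 2 * suc q * L * (suc r ^ s * r ^ k) ≤ r ^ s * falling m k) (sym length-letters) few))
      t (wordsBelow n L) (wordsBelow-short n L) (≤-<-trans (length-wordsBelow n L) many))
    where L = suc q * s

-- Exponentials against polynomials

^-distribʳ-* : ∀ m n k → (m * n) ^ k ≡ m ^ k * n ^ k
^-distribʳ-* m n zero    = refl
^-distribʳ-* m n (suc k) = trans (cong (m * n *_) (^-distribʳ-* m n k)) (interchange m n (m ^ k) (n ^ k))
  where
  interchange : ∀ a b c d → a * b * (c * d) ≡ a * c * (b * d)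
  interchange = solve-∀

-- Bernoulli's inequality `1 + j/c ≤ (1 + 1/c) ^ j` with denominators cleared.
bernoulli : ∀ c j → c ^ j * (c + j) ≤ c * suc c ^ j
bernoulli c zero    = ≤-reflexive (trans (+-identityʳ (c + 0)) (trans (+-identityʳ c) (sym (*-identityʳ c))))
bernoulli c (suc j) = begin
  c ^ suc j * (c + suc j)                 ≡⟨ expand c j (c ^ j) ⟩
  c * (c ^ j * (c + j)) + c * c ^ j       ≤⟨ +-mono-≤ (*-monoʳ-≤ c (bernoulli c j)) (*-monoʳ-≤ c (^-monoˡ-≤ j (n≤1+n c))) ⟩
  c * (c * suc c ^ j) + c * suc c ^ j     ≡⟨ collect c (suc c ^ j) ⟩
  c * suc c ^ suc j                       ∎
  where
  open ≤-Reasoning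
  expand : ∀ c j p → c * p * (c + (1 + j)) ≡ c * (p * (c + j)) + c * p
  expand = solve-∀
  collect : ∀ c p → c * (c * p) + c * p ≡ c * (p + c * p)
  collect = solve-∀

-- The fourth power of `j/c ≤ (1 + 1/c) ^ j`; `i` takes up the remainder of an exponent modulo four.
quartic≤exp : ∀ c i j → j ^ 4 * c ^ (i + j * 4) ≤ c ^ 4 * suc c ^ (i + j * 4)
quartic≤exp c i j = begin
  j ^ 4 * c ^ (i + j * 4)               ≡⟨ cong (j ^ 4 *_) (split c) ⟩
  j ^ 4 * (c ^ i * (c ^ j) ^ 4)         ≡⟨ rotate (j ^ 4) (c ^ i) ((c ^ j) ^ 4) ⟩
  c ^ i * (j ^ 4 * (c ^ j) ^ 4)         ≡⟨ cong (c ^ i *_) (^-distribʳ-* j (c ^ j) 4) ⟨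
  c ^ i * (j * c ^ j) ^ 4               ≤⟨ *-mono-≤ (^-monoˡ-≤ i (n≤1+n c)) (^-monoˡ-≤ 4 linear) ⟩
  suc c ^ i * (c * suc c ^ j) ^ 4       ≡⟨ cong (suc c ^ i *_) (^-distribʳ-* c (suc c ^ j) 4) ⟩
  suc c ^ i * (c ^ 4 * (suc c ^ j) ^ 4) ≡⟨ rotate (c ^ 4) (suc c ^ i) ((suc c ^ j) ^ 4) ⟨
  c ^ 4 * (suc c ^ i * (suc c ^ j) ^ 4) ≡⟨ cong (c ^ 4 *_) (split (suc c)) ⟨
  c ^ 4 * suc c ^ (i + j * 4)           ∎
  where
  open ≤-Reasoning
  split : ∀ m → m ^ (i + j * 4) ≡ m ^ i * (m ^ j) ^ 4
  split m = trans (^-distribˡ-+-* m i (j * 4)) (cong (m ^ i *_) (sym (^-*-assoc m j 4)))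
  rotate : ∀ a b c → a * (b * c) ≡ b * (a * c)
  rotate = solve-∀
  linear : j * c ^ j ≤ c * suc c ^ j
  linear = ≤-trans (≤-reflexive (*-comm j (c ^ j)))
    (≤-trans (*-monoʳ-≤ (c ^ j) (m≤n+m j c)) (bernoulli c j))

-- The quartic bound for `j = k / 4` has one factor `j` more than the cube, and this factor absorbs
-- all constants once `k` is large.
cubic≤exp : ∀ c C .{{_ : NonZero c}} → ∃[ K ] (∀ k → K ≤ k → C * k ^ 3 * c ^ k ≤ suc c ^ k)
cubic≤exp c C = suc j₀ * 4 , bound
  where
  -- The factor `512` is `8 ^ 3`, from `k ≤ 8 * j`; `c ^ 4` comes from the quartic bound.
  j₀ = 512 * (c ^ 4 * C)
  bound : ∀ k → suc j₀ * 4 ≤ k → C * k ^ 3 * c ^ k ≤ suc c ^ k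
  bound k ≤k = *-cancelˡ-≤ (c ^ 4) {{m^n≢0 c 4}} (begin
    c ^ 4 * (C * k ^ 3 * c ^ k)             ≡⟨ regroup (c ^ 4) C (k ^ 3) (c ^ k) ⟩
    c ^ 4 * C * k ^ 3 * c ^ k               ≤⟨ *-monoˡ-≤ (c ^ k) (*-monoʳ-≤ (c ^ 4 * C) (^-monoˡ-≤ 3 k≤8j)) ⟩
    c ^ 4 * C * (8 * j) ^ 3 * c ^ k         ≡⟨ cong (_* c ^ k) (cube (c ^ 4 * C) j) ⟩
    j₀ * j ^ 3 * c ^ k                       ≤⟨ *-monoˡ-≤ (c ^ k) (*-monoˡ-≤ (j ^ 3) (<⇒≤ j₀<j)) ⟩
    j ^ 4 * c ^ k                           ≡⟨ cong (λ l → j ^ 4 * c ^ l) (m≡m%n+[m/n]*n k 4) ⟩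
    j ^ 4 * c ^ (k % 4 + j * 4)             ≤⟨ quartic≤exp c (k % 4) j ⟩
    c ^ 4 * suc c ^ (k % 4 + j * 4)         ≡⟨ cong (λ l → c ^ 4 * suc c ^ l) (m≡m%n+[m/n]*n k 4) ⟨
    c ^ 4 * suc c ^ k                       ∎)
    where
    open ≤-Reasoning
    j = k / 4
    j₀<j : j₀ < j
    j₀<j = subst (_≤ j) (m*n/n≡m (suc j₀) 4) (/-monoˡ-≤ 4 ≤k)
    k≤8j : k ≤ 8 * j
    k≤8j = begin
      k               ≡⟨ m≡m%n+[m/n]*n k 4 ⟩
      k % 4 + j * 4   ≤⟨ +-monoˡ-≤ (j * 4) (<⇒≤ (m%n<n k 4)) ⟩
      4 + j * 4       ≤⟨ +-monoˡ-≤ (j * 4) (*-monoˡ-≤ 4 (≤-trans (s≤s z≤n) j₀<j)) ⟩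
      j * 4 + j * 4   ≡⟨ eight j ⟩
      8 * j           ∎
      where
      eight : ∀ j → j * 4 + j * 4 ≡ 8 * j
      eight = solve-∀
    regroup : ∀ a b d e → a * (b * d * e) ≡ a * b * d * e
    regroup = solve-∀
    cube : ∀ a j → a * (8 * j) ^ 3 ≡ 512 * a * j ^ 3
    cube a j = trans (cong (a *_) (^-distribʳ-* 8 j 3)) (regroup′ a (j ^ 3))
      where
      regroup′ : ∀ a b → a * (512 * b) ≡ 512 * a * b
      regroup′ = solve-∀

n<2^n : ∀ n → n < 2 ^ n
n<2^n zero    = z<s
n<2^n (suc n) = subst (suc (suc n) ≤_) (cong (2 ^ n +_) (sym (+-identityʳ (2 ^ n))))
  (+-mono-≤ (m^n>0 2 n) (n<2^n n))

-- Upper bounds for (1 + 1/r)^r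

-- eNum m = m! Σ_{i ≤ m} 1/i!
eNum : ℕ → ℕ
eNum zero    = 1
eNum (suc m) = suc m * eNum m + 1

-- taylor r i y = i! rⁱ Σ_{j ≤ i} (y/r)ʲ/j!
taylor : ℕ → ℕ → ℕ → ℕ
taylor r zero    y = 1
taylor r (suc i) y = suc i * r * taylor r i y + y ^ suc i

-- The left side consists of the two leading terms of the binomial expansion.
power-step : ∀ y m → y ^ suc m + suc m * y ^ m ≤ suc y ^ suc m
power-step y zero    = ≤-reflexive (base y)
  where
  base : ∀ y → y * 1 + 1 ≡ (1 + y) * 1
  base = solve-∀
power-step y (suc m) = begin
  y * p + (2 + m) * p                       ≤⟨ m≤m+n _ (suc m * y ^ m) ⟩
  y * p + (2 + m) * p + suc m * y ^ m       ≡⟨ expand y m (y ^ m) ⟩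
  suc y * (p + suc m * y ^ m)               ≤⟨ *-monoʳ-≤ (suc y) (power-step y m) ⟩
  suc y * suc y ^ suc m                     ∎
  where
  open ≤-Reasoning
  p = y ^ suc m
  expand : ∀ y m q → y * (y * q) + (2 + m) * (y * q) + (1 + m) * q ≡ (1 + y) * (y * q + (1 + m) * q)
  expand = solve-∀

-- The derivative of `taylor r (suc i)` is `suc i` times `taylor r i`. A polynomial with nonnegative
-- coefficients grows over a unit step by at least its derivative at the start.
taylor-step : ∀ r i y → taylor r (suc i) y + suc i * taylor r i y ≤ taylor r (suc i) (suc y)
taylor-step r zero y = ≤-reflexive (base r y)
  where
  base : ∀ r y → (1 * r) * 1 + y * 1 + 1 * 1 ≡ (1 * r) * 1 + (1 + y) * 1
  base = solve-∀
taylor-step r (suc i) y = begin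
  (2 + i) * r * h₁ + y ^ (2 + i) + (2 + i) * h₁
    ≡⟨ regroup r i y h₀ (y ^ suc i) ⟩
  (2 + i) * r * (h₁ + suc i * h₀) + (y ^ (2 + i) + (2 + i) * y ^ suc i)
    ≤⟨ +-mono-≤ (*-monoʳ-≤ ((2 + i) * r) (taylor-step r i y)) (power-step y (suc i)) ⟩
  taylor r (2 + i) (suc y) ∎
  where
  open ≤-Reasoning
  h₀ = taylor r i y
  h₁ = taylor r (suc i) y
  regroup : ∀ r i y h p →
    (2 + i) * r * ((1 + i) * r * h + p) + y * p + (2 + i) * ((1 + i) * r * h + p) ≡
    (2 + i) * r * ((1 + i) * r * h + p + (1 + i) * h) + (y * p + (2 + i) * p)
  regroup = solve-∀

-- In quotients: `(1 + 1/r) ^ j` is at most the Taylor polynomial of degree `j` of the exponential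
-- at `j/r`. The unit step of `taylor-step` pays for one more factor `1 + 1/r`.
power≤taylor : ∀ r j → suc r ^ j * j ! ≤ taylor r j j
power≤taylor r zero    = ≤-refl
power≤taylor r (suc j) = begin
  suc r * suc r ^ j * (suc j * j !)           ≡⟨ regroup (suc r) (suc r ^ j) (suc j) (j !) ⟩
  suc r * suc j * (suc r ^ j * j !)           ≤⟨ *-monoʳ-≤ (suc r * suc j) (power≤taylor r j) ⟩
  suc r * suc j * taylor r j j                ≡⟨ split r (suc j) (taylor r j j) ⟩
  suc j * r * taylor r j j + suc j * taylor r j j
    ≤⟨ +-monoˡ-≤ (suc j * taylor r j j) (m≤m+n (suc j * r * taylor r j j) (j ^ suc j)) ⟩
  taylor r (suc j) j + suc j * taylor r j j   ≤⟨ taylor-step r j j ⟩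
  taylor r (suc j) (suc j)                    ∎
  where
  open ≤-Reasoning
  regroup : ∀ a b c d → a * b * (c * d) ≡ a * c * (b * d)
  regroup = solve-∀
  split : ∀ r c h → (1 + r) * c * h ≡ c * r * h + c * h
  split = solve-∀

taylor-diagonal : ∀ r i → taylor r i r ≡ r ^ i * eNum i
taylor-diagonal r zero    = refl
taylor-diagonal r (suc i) = trans (cong (λ h → suc i * r * h + r ^ suc i) (taylor-diagonal r i))
  (regroup (suc i) r (r ^ i) (eNum i))
  where
  regroup : ∀ j r p h → j * r * (p * h) + r * p ≡ r * p * (j * h + 1)
  regroup = solve-∀

-- The partial sums `eNum m / m !` of the series for `e` increase.
eNum-lower : ∀ j r → eNum r * (j + r) ! ≤ eNum (j + r) * r !
eNum-lower zero    r = ≤-refl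
eNum-lower (suc j) r = begin
  eNum r * (suc (j + r) * (j + r) !)        ≡⟨ regroup (eNum r) (suc (j + r)) ((j + r) !) ⟩
  suc (j + r) * (eNum r * (j + r) !)        ≤⟨ *-monoʳ-≤ (suc (j + r)) (eNum-lower j r) ⟩
  suc (j + r) * (eNum (j + r) * r !)        ≡⟨ *-assoc (suc (j + r)) (eNum (j + r)) (r !) ⟨
  suc (j + r) * eNum (j + r) * r !          ≤⟨ *-monoˡ-≤ (r !) (m≤m+n (suc (j + r) * eNum (j + r)) 1) ⟩
  eNum (suc (j + r)) * r !                  ∎
  where
  open ≤-Reasoning
  regroup : ∀ a b c → a * (b * c) ≡ b * (a * c)
  regroup = solve-∀

-- The partial sum plus its last term, `(eNum m + 1) / m !`, does not increase from `m = 1` on,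
-- because twice the next term is at most the last one.
eNum-upper : ∀ j m → .{{_ : NonZero m}} → suc (eNum (j + m)) * m ! ≤ suc (eNum m) * (j + m) !
eNum-upper zero    m = ≤-refl
eNum-upper (suc j) m = begin
  suc (suc l * eNum l + 1) * m !    ≤⟨ *-monoˡ-≤ (m !) suc≤ ⟩
  suc l * suc (eNum l) * m !        ≡⟨ *-assoc (suc l) (suc (eNum l)) (m !) ⟩
  suc l * (suc (eNum l) * m !)      ≤⟨ *-monoʳ-≤ (suc l) (eNum-upper j m) ⟩
  suc l * (suc (eNum m) * l !)      ≡⟨ regroup (suc l) (suc (eNum m)) (l !) ⟩
  suc (eNum m) * (suc l * l !)      ∎
  where
  open ≤-Reasoning
  l = j + m
  regroup : ∀ a b c → a * (b * c) ≡ b * (a * c)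
  regroup = solve-∀
  swap : ∀ x → 1 + (x + 1) ≡ 2 + x
  swap = solve-∀
  suc≤ : suc (suc l * eNum l + 1) ≤ suc l * suc (eNum l)
  suc≤ = begin
    suc (suc l * eNum l + 1)    ≡⟨ swap (suc l * eNum l) ⟩
    2 + suc l * eNum l          ≤⟨ +-monoˡ-≤ (suc l * eNum l) (s≤s (≤-trans (>-nonZero⁻¹ m) (m≤n+m m j))) ⟩
    suc l + suc l * eNum l      ≡⟨ *-suc (suc l) (eNum l) ⟨
    suc l * suc (eNum l)        ∎

-- So `(eNum m + 1) / m !` bounds all partial sums of `e`: those up to `m` by monotonicity, the
-- later ones by `eNum-upper`.
eNum-ratio : ∀ r m → .{{_ : NonZero m}} → eNum r * m ! ≤ suc (eNum m) * r !
eNum-ratio r m with ≤-total r m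
... | inj₁ r≤m = ≤-trans
  (subst (λ l → eNum r * l ! ≤ eNum l * r !) (m∸n+n≡m r≤m) (eNum-lower (m ∸ r) r))
  (*-monoˡ-≤ (r !) (n≤1+n (eNum m)))
... | inj₂ m≤r = ≤-trans (*-monoˡ-≤ (m !) (n≤1+n (eNum r)))
  (subst (λ l → suc (eNum l) * m ! ≤ suc (eNum m) * l !) (m∸n+n≡m m≤r) (eNum-upper (r ∸ m) m))

-- At `y = r` the Taylor polynomial is a partial sum of `e`, which gives a rational upper bound that
-- is uniform in `r`.
[1+1/r]^r≤ : ∀ r m → .{{_ : NonZero m}} → suc r ^ r * m ! ≤ r ^ r * suc (eNum m)
[1+1/r]^r≤ r m = *-cancelʳ-≤ _ _ (r !) {{r !≢0}} (begin
  suc r ^ r * m ! * r !           ≡⟨ swap (suc r ^ r) (m !) (r !) ⟩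
  suc r ^ r * r ! * m !           ≤⟨ *-monoˡ-≤ (m !) (power≤taylor r r) ⟩
  taylor r r r * m !              ≡⟨ cong (_* m !) (taylor-diagonal r r) ⟩
  r ^ r * eNum r * m !            ≡⟨ *-assoc (r ^ r) (eNum r) (m !) ⟩
  r ^ r * (eNum r * m !)          ≤⟨ *-monoʳ-≤ (r ^ r) (eNum-ratio r m) ⟩
  r ^ r * (suc (eNum m) * r !)    ≡⟨ *-assoc (r ^ r) (suc (eNum m)) (r !) ⟨
  r ^ r * suc (eNum m) * r !      ∎)
  where
  open ≤-Reasoning
  swap : ∀ a b c → a * b * c ≡ a * c * b
  swap = solve-∀

m!≤eNum : ∀ m → m ! ≤ eNum m
m!≤eNum zero    = ≤-refl
m!≤eNum (suc m) = ≤-trans (*-monoʳ-≤ (suc m) (m!≤eNum m)) (m≤m+n _ 1)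

-- Choice of parameters

triple-sum : ∀ {x y z u} → 3 * x ≤ u → 3 * y ≤ u → 3 * z ≤ u → x + y + z ≤ u
triple-sum {x} {y} {z} {u} 3x 3y 3z = *-cancelˡ-≤ 3 (begin
  3 * (x + y + z)         ≡⟨ expand x y z ⟩
  3 * x + 3 * y + 3 * z   ≤⟨ +-mono-≤ (+-mono-≤ 3x 3y) 3z ⟩
  u + u + u               ≡⟨ collect u ⟩
  3 * u                   ∎)
  where
  open ≤-Reasoning
  expand : ∀ x y z → 3 * (x + y + z) ≡ 3 * x + 3 * y + 3 * z
  expand = solve-∀
  collect : ∀ u → u + u + u ≡ 3 * u
  collect = solve-∀

-- With `a / b` as upper bound for `e`, a window holds at most `(a r / b) ^ k ≤ (c k) ^ k` blocks,
-- out of at least `((c + 1) k) ^ k`. The quotient `(1 + 1/c) ^ k` outgrows the polynomial factor.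
few-bound : ∀ c k r a b s .{{_ : NonZero b}} .{{_ : NonZero r}} →
  s ≡ k * r → suc r ^ r * b ≤ r ^ r * a → a * r ≤ c * k * b → r ≤ c * k →
  2 * (2 + c) * ((2 + c) * c) * k ^ 3 * c ^ k ≤ suc c ^ k → .{{_ : NonZero k}} →
  2 * (2 + c) * ((2 + c) * s) * (suc r ^ s * r ^ k) ≤ r ^ s * falling ((2 + c) * k) k
few-bound c k r a b s refl e-bound ar≤ r≤ cubic = begin
  2 * (2 + c) * ((2 + c) * (k * r)) * (suc r ^ s * r ^ k)
    ≤⟨ *-mono-≤ (*-monoʳ-≤ (2 * (2 + c)) (*-monoʳ-≤ (2 + c) (*-monoʳ-≤ k r≤))) powers ⟩
  2 * (2 + c) * ((2 + c) * (k * (c * k))) * (r ^ s * (c ^ k * k ^ k))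
    ≡⟨ regroup c k (r ^ s) (c ^ k) (k ^ k) ⟩
  r ^ s * (2 * (2 + c) * ((2 + c) * c) * (k * k) * c ^ k * k ^ k)
    ≤⟨ *-monoʳ-≤ (r ^ s) (*-monoˡ-≤ (k ^ k) (≤-trans (*-monoˡ-≤ (c ^ k)
         (*-monoʳ-≤ (2 * (2 + c) * ((2 + c) * c)) square≤cube)) cubic)) ⟩
  r ^ s * (suc c ^ k * k ^ k)
    ≡⟨ cong (r ^ s *_) (^-distribʳ-* (suc c) k k) ⟨
  r ^ s * (suc c * k) ^ k
    ≤⟨ *-monoʳ-≤ (r ^ s) (falling-≥ (suc c * k) k) ⟩
  r ^ s * falling ((2 + c) * k) k ∎
  where
  open ≤-Reasoning
  regroup : ∀ c k p x y → 2 * (2 + c) * ((2 + c) * (k * (c * k))) * (p * (x * y)) ≡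
                          p * (2 * (2 + c) * ((2 + c) * c) * (k * k) * x * y)
  regroup = solve-∀
  square≤cube : k * k ≤ k ^ 3
  square≤cube = *-monoʳ-≤ k (m≤m*n k (k * 1) {{m*n≢0 k 1}})
  split : ∀ x → x ^ (k * r) ≡ (x ^ r) ^ k
  split x = trans (cong (x ^_) (*-comm k r)) (sym (^-*-assoc x r k))
  swap : ∀ x y z → x * y * z ≡ x * z * y
  swap = solve-∀
  powers : suc r ^ s * r ^ k ≤ r ^ s * (c ^ k * k ^ k)
  powers = *-cancelʳ-≤ _ _ (b ^ k) {{m^n≢0 b k}} (begin
    suc r ^ s * r ^ k * b ^ k           ≡⟨ swap (suc r ^ s) (r ^ k) (b ^ k) ⟩
    suc r ^ s * b ^ k * r ^ k           ≡⟨ cong (λ x → x * b ^ k * r ^ k) (split (suc r)) ⟩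
    (suc r ^ r) ^ k * b ^ k * r ^ k     ≡⟨ cong (_* r ^ k) (^-distribʳ-* (suc r ^ r) b k) ⟨
    (suc r ^ r * b) ^ k * r ^ k         ≤⟨ *-monoˡ-≤ (r ^ k) (^-monoˡ-≤ k e-bound) ⟩
    (r ^ r * a) ^ k * r ^ k             ≡⟨ cong (_* r ^ k) (^-distribʳ-* (r ^ r) a k) ⟩
    (r ^ r) ^ k * a ^ k * r ^ k         ≡⟨ cong (λ x → x * a ^ k * r ^ k) (split r) ⟨
    r ^ s * a ^ k * r ^ k               ≡⟨ *-assoc (r ^ s) (a ^ k) (r ^ k) ⟩
    r ^ s * (a ^ k * r ^ k)             ≡⟨ cong (r ^ s *_) (^-distribʳ-* a r k) ⟨
    r ^ s * (a * r) ^ k                 ≤⟨ *-monoʳ-≤ (r ^ s) (^-monoˡ-≤ k ar≤) ⟩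
    r ^ s * (c * k * b) ^ k             ≡⟨ cong (r ^ s *_) (trans (^-distribʳ-* (c * k) b k) (cong (_* b ^ k) (^-distribʳ-* c k k))) ⟩
    r ^ s * (c ^ k * k ^ k * b ^ k)     ≡⟨ *-assoc (r ^ s) (c ^ k * k ^ k) (b ^ k) ⟨
    r ^ s * (c ^ k * k ^ k) * b ^ k     ∎)

-- The base-two logarithm of the left side is at most `n * L`, which is cubic in `k` and therefore
-- below `2 ^ k ≤ 2 ^ t`.
many-bound : ∀ c k r n t → r ≤ c * k → n ≤ (c + 6) * k → k ≤ t →
  suc ((c + 6) * ((2 + c) * c)) * k ^ 3 * 1 ^ k ≤ 2 ^ k → .{{_ : NonZero k}} →
  suc n ^ ((2 + c) * (k * r)) < 2 ^ (2 ^ t)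
many-bound c k r n t r≤ n≤ k≤t cubic = begin-strict
  suc n ^ L             ≤⟨ ^-monoˡ-≤ L (n<2^n n) ⟩
  (2 ^ n) ^ L           ≡⟨ ^-*-assoc 2 n L ⟩
  2 ^ (n * L)           <⟨ ^-monoʳ-< 2 ≤-refl nL<2^t ⟩
  2 ^ (2 ^ t)           ∎
  where
  open ≤-Reasoning
  L = (2 + c) * (k * r)
  C = (c + 6) * ((2 + c) * c)
  instance
    k³≢0 : NonZero (k ^ 3)
    k³≢0 = m^n≢0 k 3
  regroup : ∀ c k → (c + 6) * k * ((2 + c) * (k * (c * k))) ≡ (c + 6) * ((2 + c) * c) * (k * (k * (k * 1)))
  regroup = solve-∀
  nL<2^t : n * L < 2 ^ t
  nL<2^t = begin-strict
    n * L                                     ≤⟨ *-mono-≤ n≤ (*-monoʳ-≤ (2 + c) (*-monoʳ-≤ k r≤)) ⟩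
    (c + 6) * k * ((2 + c) * (k * (c * k)))   ≡⟨ regroup c k ⟩
    C * k ^ 3                                 <⟨ *-monoˡ-< (k ^ 3) (n<1+n C) ⟩
    suc C * k ^ 3                             ≡⟨ *-identityʳ _ ⟨
    suc C * k ^ 3 * 1                         ≡⟨ cong (suc C * k ^ 3 *_) (^-zeroˡ k) ⟨
    suc C * k ^ 3 * 1 ^ k                     ≤⟨ cubic ⟩
    2 ^ k                                     ≤⟨ ^-monoʳ-≤ 2 k≤t ⟩
    2 ^ t                                     ∎

-- In quotients this is `(b/A - 1/D) n ^ 2 ≤ L`, where `b/A` will be the reciprocal of a partial sum
-- of `e`.
length-bound : ∀ D A b k r n → let c = 36 * D in
  3 * D ≤ b → b ≤ A → 1 ≤ A → 6 * D ≤ n → r ≤ c * k →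
  c * k * b ≤ suc A * suc r → (2 + c) * k ≤ n → n ≤ (c + 6) * k →
  b * (D * (n * n)) ≤ A * (n * n + D * ((2 + c) * (k * r)))
length-bound D A b k r n 3D≤b b≤A 1≤A 6D≤n r≤ ckb≤ ≤n n≤ = begin
  b * (D * (n * n))
    ≤⟨ *-monoʳ-≤ b (*-monoʳ-≤ D n²≤) ⟩
  b * (D * (c * k * ((2 + c) * k) + 12 * (k * n)))
    ≡⟨ expand b D c k n ⟩
  D * ((2 + c) * k) * (c * k * b) + 12 * (D * b * k * n)
    ≤⟨ +-monoˡ-≤ (12 * (D * b * k * n)) (*-monoʳ-≤ (D * ((2 + c) * k)) ckb≤) ⟩
  D * ((2 + c) * k) * (suc A * suc r) + 12 * (D * b * k * n)
    ≡⟨ separate A D c k r (12 * (D * b * k * n)) ⟩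
  A * (D * L) + (D * L + D * ((2 + c) * k) * suc A + 12 * (D * b * k * n))
    -- The three losses come from `suc A` in place of `A`, from rounding `r` down, and from
    -- replacing `n * n` by `c * k * ((2 + c) * k)`. Each is at most a third of `A * (n * n)`.
    ≤⟨ +-monoʳ-≤ (A * (D * L)) (triple-sum {D * L} first second third) ⟩
  A * (D * L) + A * (n * n)
    ≡⟨ collect A (n * n) (D * L) ⟩
  A * (n * n + D * L) ∎
  where
  open ≤-Reasoning
  c = 36 * D
  L = (2 + c) * (k * r)
  expand : ∀ b D c k n → b * (D * (c * k * ((2 + c) * k) + 12 * (k * n))) ≡
                         D * ((2 + c) * k) * (c * k * b) + 12 * (D * b * k * n)
  expand = solve-∀
  separate : ∀ A D c k r z → D * ((2 + c) * k) * ((1 + A) * (1 + r)) + z ≡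
    A * (D * ((2 + c) * (k * r))) + (D * ((2 + c) * (k * r)) + D * ((2 + c) * k) * (1 + A) + z)
  separate = solve-∀
  collect : ∀ A x y → A * y + A * x ≡ A * (x + y)
  collect = solve-∀
  ck≤n : c * k ≤ n
  ck≤n = ≤-trans (*-monoˡ-≤ k (m≤n+m c 2)) ≤n
  n²≤ : n * n ≤ c * k * ((2 + c) * k) + 12 * (k * n)
  n²≤ = begin
    n * n                                       ≤⟨ *-monoʳ-≤ n n≤ ⟩
    n * ((c + 6) * k)                           ≡⟨ step₁ n c k ⟩
    c * k * n + 6 * (k * n)                     ≤⟨ +-monoˡ-≤ (6 * (k * n)) (*-monoʳ-≤ (c * k) n≤) ⟩
    c * k * ((c + 6) * k) + 6 * (k * n)         ≡⟨ step₂ n c k ⟩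
    c * k * (c * k) + 6 * (k * (c * k)) + 6 * (k * n)
      ≤⟨ +-monoˡ-≤ (6 * (k * n)) (+-mono-≤ (*-monoʳ-≤ (c * k) (*-monoˡ-≤ k (m≤n+m c 2)))
           (*-monoʳ-≤ 6 (*-monoʳ-≤ k ck≤n))) ⟩
    c * k * ((2 + c) * k) + 6 * (k * n) + 6 * (k * n) ≡⟨ step₃ (c * k * ((2 + c) * k)) (k * n) ⟩
    c * k * ((2 + c) * k) + 12 * (k * n)        ∎
    where
    step₁ : ∀ n c k → n * ((c + 6) * k) ≡ c * k * n + 6 * (k * n)
    step₁ = solve-∀
    step₂ : ∀ n c k → c * k * ((c + 6) * k) + 6 * (k * n) ≡ c * k * (c * k) + 6 * (k * (c * k)) + 6 * (k * n)
    step₂ = solve-∀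
    step₃ : ∀ x y → x + 6 * y + 6 * y ≡ x + 12 * y
    step₃ = solve-∀
  first : 3 * (D * L) ≤ A * (n * n)
  first = begin
    3 * (D * L)                     ≡⟨ *-assoc 3 D L ⟨
    3 * D * L                       ≤⟨ *-monoˡ-≤ L (≤-trans 3D≤b b≤A) ⟩
    A * L                           ≡⟨ cong (A *_) (*-assoc (2 + c) k r) ⟨
    A * ((2 + c) * k * r)           ≤⟨ *-monoʳ-≤ A (*-mono-≤ ≤n (≤-trans r≤ ck≤n)) ⟩
    A * (n * n)                     ∎
  second : 3 * (D * ((2 + c) * k) * suc A) ≤ A * (n * n)
  second = begin
    3 * (D * ((2 + c) * k) * suc A)   ≤⟨ *-monoʳ-≤ 3 (*-mono-≤ (*-monoʳ-≤ D ≤n) (+-monoˡ-≤ A 1≤A)) ⟩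
    3 * (D * n * (A + A))             ≡⟨ step D n A ⟩
    A * (6 * D * n)                   ≤⟨ *-monoʳ-≤ A (*-monoˡ-≤ n 6D≤n) ⟩
    A * (n * n)                       ∎
    where
    step : ∀ D n A → 3 * (D * n * (A + A)) ≡ A * (6 * D * n)
    step = solve-∀
  third : 3 * (12 * (D * b * k * n)) ≤ A * (n * n)
  third = begin
    -- The choice `c = 36 * D` makes this loss small enough.
    3 * (12 * (D * b * k * n))    ≡⟨ step D b k n ⟩
    b * (c * k * n)               ≤⟨ *-mono-≤ b≤A (*-monoˡ-≤ n ck≤n) ⟩
    A * (n * n)                   ∎
    where
    step : ∀ D b k n → 3 * (12 * (D * b * k * n)) ≡ b * (36 * D * k * n)
    step = solve-∀

SlowNetwork : ℕ → ℕ → Set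
SlowNetwork n L = ∃[ f ] Increasing {n} f × (∀ w → Fixes w f → L ≤ length w)

-- About `n / (3 + c)` components are kept for the selector, and the others form `2 + c` blocks of
-- `k` letters. The number `r` is the largest for which `r` times the upper bound
-- `(eNum m + 1) / m !` for `e` is at most `c * k`.
slow-networks : ∀ D .{{_ : NonZero D}} → let m = 3 * D in
  ∃[ K ] (∀ n → K ≤ n → ∃[ L ] SlowNetwork n L × m ! * (D * (n * n)) ≤ eNum m * (n * n + D * L))
slow-networks D = K * (3 + c) , construct
  where
  m = 3 * D
  c = 36 * D
  A = eNum m
  b = m !
  instance
    m≢0 : NonZero m
    m≢0 = m*n≢0 3 D
    c≢0 : NonZero c
    c≢0 = m*n≢0 36 D
    b≢0 : NonZero b
    b≢0 = m !≢0
  K₁ = cubic≤exp c (2 * (2 + c) * ((2 + c) * c))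
  K₂ = cubic≤exp 1 (suc ((c + 6) * ((2 + c) * c)))
  -- This makes `r` positive and the remainder of `n` modulo `3 + c` at most `k`.
  K₀ = suc A + (3 + c)
  K = K₀ ⊔ (proj₁ K₁ ⊔ proj₁ K₂)
  construct : ∀ n → K * (3 + c) ≤ n →
    ∃[ L ] SlowNetwork n L × m ! * (D * (n * n)) ≤ eNum m * (n * n + D * L)
  construct n K≤n = L , subst (λ l → SlowNetwork l L) (sym n≡)
    -- The number of blocks is one more than the first argument, hence `2 + c`.
    (slow-network (suc c) k t r (k * r)
      (few-bound c k r (suc A) b (k * r) refl ([1+1/r]^r≤ r m) ar≤ r≤
        (proj₂ K₁ k (m⊔n≤o⇒m≤o (proj₁ K₁) (proj₁ K₂) K₁₂≤k)))
      (subst (λ l → suc l ^ L < 2 ^ (2 ^ t)) n≡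
        (many-bound c k r n t r≤ n≤ (m≤m+n k (n % (3 + c)))
          (proj₂ K₂ k (m⊔n≤o⇒n≤o (proj₁ K₁) (proj₁ K₂) K₁₂≤k))))) ,
    length-bound D A b k r n (n≤n! m) (m!≤eNum m) (≤-trans (>-nonZero⁻¹ b) (m!≤eNum m))
      6D≤n r≤ ckb≤ ≤n n≤
    where
    open ≤-Reasoning
    k = n / (3 + c)
    t = k + n % (3 + c)
    r = c * k * b / suc A
    L = (2 + c) * (k * r)
    regroup : ∀ c k x → x + k * (3 + c) ≡ (2 + c) * k + (k + x)
    regroup = solve-∀
    n≡ : n ≡ (2 + c) * k + t
    n≡ = trans (m≡m%n+[m/n]*n n (3 + c)) (regroup c k (n % (3 + c)))
    K≤k : K ≤ k
    K≤k = subst (_≤ k) (m*n/n≡m K (3 + c)) (/-monoˡ-≤ (3 + c) K≤n)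
    K₀≤k : K₀ ≤ k
    K₀≤k = m⊔n≤o⇒m≤o K₀ (proj₁ K₁ ⊔ proj₁ K₂) K≤k
    K₁₂≤k : proj₁ K₁ ⊔ proj₁ K₂ ≤ k
    K₁₂≤k = m⊔n≤o⇒n≤o K₀ (proj₁ K₁ ⊔ proj₁ K₂) K≤k
    instance
      k≢0 : NonZero k
      k≢0 = >-nonZero (≤-trans (s≤s z≤n) K₀≤k)
    a≤ckb : suc A ≤ c * k * b
    a≤ckb = begin
      suc A           ≤⟨ m≤m+n (suc A) (3 + c) ⟩
      K₀              ≤⟨ K₀≤k ⟩
      k               ≤⟨ m≤n*m k c ⟩
      c * k           ≤⟨ m≤m*n (c * k) b ⟩
      c * k * b       ∎
    instance
      r≢0 : NonZero r
      r≢0 = >-nonZero (m≥n⇒m/n>0 a≤ckb)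
    ar≤ : suc A * r ≤ c * k * b
    ar≤ = subst (_≤ c * k * b) (*-comm r (suc A)) (m/n*n≤m (c * k * b) (suc A))
    ckb≤ : c * k * b ≤ suc A * suc r
    ckb≤ = begin
      c * k * b                             ≡⟨ m≡m%n+[m/n]*n (c * k * b) (suc A) ⟩
      c * k * b % suc A + r * suc A         ≤⟨ +-monoˡ-≤ (r * suc A) (<⇒≤ (m%n<n (c * k * b) (suc A))) ⟩
      suc r * suc A                         ≡⟨ *-comm (suc r) (suc A) ⟩
      suc A * suc r                         ∎
    r≤ : r ≤ c * k
    r≤ = *-cancelˡ-≤ (suc A) (begin
      suc A * r         ≤⟨ ar≤ ⟩
      c * k * b         ≤⟨ *-monoʳ-≤ (c * k) (m≤n⇒m≤1+n (m!≤eNum m)) ⟩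
      c * k * suc A     ≡⟨ *-comm (c * k) (suc A) ⟩
      suc A * (c * k)   ∎)
    ≤n : (2 + c) * k ≤ n
    ≤n = subst ((2 + c) * k ≤_) (sym n≡) (m≤m+n _ t)
    rest≤ : ∀ c k → (2 + c) * k + (k + k) + 2 * k ≡ (c + 6) * k
    rest≤ = solve-∀
    n≤ : n ≤ (c + 6) * k
    n≤ = begin
      n                                   ≡⟨ n≡ ⟩
      (2 + c) * k + (k + n % (3 + c))     ≤⟨ +-monoʳ-≤ ((2 + c) * k) (+-monoʳ-≤ k (≤-trans (<⇒≤ (m%n<n n (3 + c)))
                                               (≤-trans (m≤n+m (3 + c) (suc A)) K₀≤k))) ⟩
      (2 + c) * k + (k + k)               ≤⟨ m≤m+n _ (2 * k) ⟩
      (2 + c) * k + (k + k) + 2 * k       ≡⟨ rest≤ c k ⟩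
      (c + 6) * k                         ∎
    6D≤n : 6 * D ≤ n
    6D≤n = begin
      6 * D         ≤⟨ *-monoˡ-≤ D (m≤m+n 6 30) ⟩
      c             ≤⟨ m≤n+m c 2 ⟩
      2 + c         ≤⟨ m≤m*n (2 + c) k ⟩
      (2 + c) * k   ≤⟨ ≤n ⟩
      n             ∎

-- Passage to the reals

open import Data.Integer.Base using (+_)

ι : ℕ → ℚ
ι x = + x ℚ./ 1

ι-+ : ∀ x y → ι (x + y) ≡ ι x ℚ.+ ι y
ι-+ x y = ℚ.toℚᵘ-injective (begin-equality
  ℚ.toℚᵘ (ι (x + y))                        ≃⟨ toℚᵘ-/ (+ (x + y)) 0 ⟩
  ℚᵘ.mkℚᵘ (+ (x + y)) 0                     ≃⟨ ℚᵘ.*≡* (cong (ℤ._* + 1) (sym (cong₂ ℤ._+_ (ℤ.*-identityʳ (+ x)) (ℤ.*-identityʳ (+ y))))) ⟩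
  ℚᵘ.mkℚᵘ (+ x) 0 ℚᵘ.+ ℚᵘ.mkℚᵘ (+ y) 0        ≃⟨ ℚᵘ.+-cong (toℚᵘ-/ (+ x) 0) (toℚᵘ-/ (+ y) 0) ⟨
  ℚ.toℚᵘ (ι x) ℚᵘ.+ ℚ.toℚᵘ (ι y)              ≃⟨ ℚ.toℚᵘ-homo-+ (ι x) (ι y) ⟨
  ℚ.toℚᵘ (ι x ℚ.+ ι y)                        ∎)
  where open ℚᵘ.≤-Reasoning

ι-* : ∀ x y → ι (x * y) ≡ ι x ℚ.* ι y
ι-* x y = ℚ.toℚᵘ-injective (begin-equality
  ℚ.toℚᵘ (ι (x * y))                        ≃⟨ toℚᵘ-/ (+ (x * y)) 0 ⟩
  ℚᵘ.mkℚᵘ (+ (x * y)) 0                     ≃⟨ ℚᵘ.*≡* (cong (ℤ._* + 1) (ℤ.pos-* x y)) ⟩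
  ℚᵘ.mkℚᵘ (+ x) 0 ℚᵘ.* ℚᵘ.mkℚᵘ (+ y) 0        ≃⟨ ℚᵘ.*-cong (toℚᵘ-/ (+ x) 0) (toℚᵘ-/ (+ y) 0) ⟨
  ℚ.toℚᵘ (ι x) ℚᵘ.* ℚ.toℚᵘ (ι y)              ≃⟨ ℚ.toℚᵘ-homo-* (ι x) (ι y) ⟨
  ℚ.toℚᵘ (ι x ℚ.* ι y)                        ∎)
  where open ℚᵘ.≤-Reasoning

ι-mono : ∀ {x y} → x ≤ y → ι x ℚ.≤ ι y
ι-mono {x} {y} x≤y = ℚ.toℚᵘ-cancel-≤ (begin
  ℚ.toℚᵘ (ι x)        ≃⟨ toℚᵘ-/ (+ x) 0 ⟩
  ℚᵘ.mkℚᵘ (+ x) 0     ≤⟨ ℚᵘ.*≤* (ℤ.*-monoʳ-≤-nonNeg (+ 1) (ℤ.+≤+ x≤y)) ⟩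
  ℚᵘ.mkℚᵘ (+ y) 0     ≃⟨ toℚᵘ-/ (+ y) 0 ⟨
  ℚ.toℚᵘ (ι y)        ∎)
  where open ℚᵘ.≤-Reasoning

ι-nonNeg : ∀ x → ℚ.NonNegative (ι x)
ι-nonNeg x = ℚ.nonNegative (ι-mono {0} {x} z≤n)

ι-pos : ∀ x .{{_ : NonZero x}} → ℚ.Positive (ι x)
ι-pos x = ℚ.normalize-pos x 1

1/d*d : ∀ d .{{_ : NonZero d}} → + 1 ℚ./ d ℚ.* ι d ≡ 1ℚ
1/d*d (suc d) = ℚ.toℚᵘ-injective (begin-equality
  ℚ.toℚᵘ (+ 1 ℚ./ suc d ℚ.* ι (suc d))              ≃⟨ ℚ.toℚᵘ-homo-* (+ 1 ℚ./ suc d) (ι (suc d)) ⟩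
  ℚ.toℚᵘ (+ 1 ℚ./ suc d) ℚᵘ.* ℚ.toℚᵘ (ι (suc d))    ≃⟨ ℚᵘ.*-cong (toℚᵘ-/ (+ 1) d) (toℚᵘ-/ (+ suc d) 0) ⟩
  ℚᵘ.mkℚᵘ (+ 1) d ℚᵘ.* ℚᵘ.mkℚᵘ (+ suc d) 0          ≃⟨ ℚᵘ.*≡* (cong +_ (cross d)) ⟩
  ℚᵘ.1ℚᵘ                                            ∎)
  where
  open ℚᵘ.≤-Reasoning
  cross : ∀ d → 1 * suc d * 1 ≡ 1 * (suc d * 1)
  cross d = *-assoc 1 (suc d) 1

eSum*m! : ∀ m → eSum m ℚ.* ι (m !) ≡ ι (eNum m)
eSum*m! zero    = refl
eSum*m! (suc m) = begin
  (eSum m ℚ.+ 1/[ suc m ]!) ℚ.* ι (suc m !)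
    ≡⟨ ℚ.*-distribʳ-+ (ι (suc m !)) (eSum m) 1/[ suc m ]! ⟩
  eSum m ℚ.* ι (suc m !) ℚ.+ 1/[ suc m ]! ℚ.* ι (suc m !)
    ≡⟨ cong₂ ℚ._+_ (cong (eSum m ℚ.*_) (ι-* (suc m) (m !))) (1/d*d (suc m !) {{suc m !≢0}}) ⟩
  eSum m ℚ.* (ι (suc m) ℚ.* ι (m !)) ℚ.+ 1ℚ
    ≡⟨ cong (ℚ._+ 1ℚ) (rotate (eSum m) (ι (suc m)) (ι (m !))) ⟩
  ι (suc m) ℚ.* (eSum m ℚ.* ι (m !)) ℚ.+ 1ℚ
    ≡⟨ cong (λ p → ι (suc m) ℚ.* p ℚ.+ 1ℚ) (eSum*m! m) ⟩
  ι (suc m) ℚ.* ι (eNum m) ℚ.+ ι 1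
    ≡⟨ cong (ℚ._+ ι 1) (ι-* (suc m) (eNum m)) ⟨
  ι (suc m * eNum m) ℚ.+ ι 1
    ≡⟨ ι-+ (suc m * eNum m) 1 ⟨
  ι (eNum (suc m)) ∎
  where
  open ≡-Reasoning
  open +-*-Solver
  rotate : ∀ a b c → a ℚ.* (b ℚ.* c) ≡ b ℚ.* (a ℚ.* c)
  rotate = solve 3 (λ a b c → a :* (b :* c) := b :* (a :* c)) refl

-- The numerator of a positive rational is at least one. Hence the denominator can serve as an
-- integer `D` with `1/D ≤ δ`.
1≤δ*↧δ : ∀ δ → 0ℚ ℚ.< δ → 1ℚ ℚ.≤ δ ℚ.* ι (ℚ.↧ₙ δ)
1≤δ*↧δ δ@(mkℚ +[1+ p ] q-1 _) _ = ℚ.toℚᵘ-cancel-≤ (begin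
  ℚᵘ.1ℚᵘ                                            ≤⟨ ℚᵘ.*≤* (ℤ.+≤+ cross) ⟩
  ℚᵘ.mkℚᵘ +[1+ p ] q-1 ℚᵘ.* ℚᵘ.mkℚᵘ (+ suc q-1) 0   ≃⟨ ℚᵘ.*-congˡ {ℚ.toℚᵘ δ} (toℚᵘ-/ (+ suc q-1) 0) ⟨
  ℚ.toℚᵘ δ ℚᵘ.* ℚ.toℚᵘ (ι (suc q-1))                ≃⟨ ℚ.toℚᵘ-homo-* δ (ι (suc q-1)) ⟨
  ℚ.toℚᵘ (δ ℚ.* ι (suc q-1))                        ∎)
  where
  open ℚᵘ.≤-Reasoning
  cross : 1 * (suc q-1 * 1) ≤ suc p * suc q-1 * 1
  cross = subst (1 * (suc q-1 * 1) ≤_) (sym (*-assoc (suc p) (suc q-1) 1))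
    (*-monoˡ-≤ (suc q-1 * 1) (s≤s (z≤n {p})))
1≤δ*↧δ (mkℚ (+ zero) _ _) 0<δ with ℚ.positive 0<δ
... | ()
1≤δ*↧δ (mkℚ ℤ.-[1+ _ ] _ _) 0<δ with ℚ.positive 0<δ
... | ()

-- Multiplying the last hypothesis by `u = 1/s` and dividing by `d` gives `(u - 1/d) y ≤ ℓ`, and
-- `1/d ≤ ε`.
reciprocal-bound : ∀ {s u ε d y ℓ} .{{_ : ℚ.NonNegative u}} .{{_ : ℚ.Positive d}} .{{_ : ℚ.NonNegative y}} →
  s ℚ.* u ≡ 1ℚ → 1ℚ ℚ.≤ ε ℚ.* d → d ℚ.* y ℚ.≤ s ℚ.* (y ℚ.+ d ℚ.* ℓ) → (u ℚ.- ε) ℚ.* y ℚ.≤ ℓ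
reciprocal-bound {s} {u} {ε} {d} {y} {ℓ} su≡1 1≤εd dy≤ = ℚ.*-cancelʳ-≤-pos d (begin
  (u ℚ.- ε) ℚ.* y ℚ.* d                               ≡⟨ expand u ε y d ⟩
  d ℚ.* y ℚ.* u ℚ.- ε ℚ.* d ℚ.* y                     ≤⟨ ℚ.+-mono-≤ (ℚ.*-monoʳ-≤-nonNeg u dy≤)
                                                           (ℚ.neg-antimono-≤ (ℚ.*-monoʳ-≤-nonNeg y 1≤εd)) ⟩
  s ℚ.* (y ℚ.+ d ℚ.* ℓ) ℚ.* u ℚ.- 1ℚ ℚ.* y            ≡⟨ regroup s u y d ℓ ⟩
  s ℚ.* u ℚ.* (y ℚ.+ d ℚ.* ℓ) ℚ.- 1ℚ ℚ.* y            ≡⟨ cong (λ p → p ℚ.* (y ℚ.+ d ℚ.* ℓ) ℚ.- 1ℚ ℚ.* y) su≡1 ⟩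
  1ℚ ℚ.* (y ℚ.+ d ℚ.* ℓ) ℚ.- 1ℚ ℚ.* y                 ≡⟨ cong₂ ℚ._-_ (ℚ.*-identityˡ (y ℚ.+ d ℚ.* ℓ)) (ℚ.*-identityˡ y) ⟩
  y ℚ.+ d ℚ.* ℓ ℚ.- y                                 ≡⟨ cancel y d ℓ ⟩
  ℓ ℚ.* d                                             ∎)
  where
  open ℚ.≤-Reasoning
  open +-*-Solver
  expand : ∀ u ε y d → (u ℚ.- ε) ℚ.* y ℚ.* d ≡ d ℚ.* y ℚ.* u ℚ.- ε ℚ.* d ℚ.* y
  expand = solve 4 (λ u ε y d → (u :- ε) :* y :* d := d :* y :* u :- ε :* d :* y) refl
  regroup : ∀ s u y d ℓ → s ℚ.* (y ℚ.+ d ℚ.* ℓ) ℚ.* u ℚ.- 1ℚ ℚ.* y ≡ s ℚ.* u ℚ.* (y ℚ.+ d ℚ.* ℓ) ℚ.- 1ℚ ℚ.* y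
  regroup s u y d ℓ = cong (ℚ._- 1ℚ ℚ.* y)
    (solve 3 (λ s u x → s :* x :* u := s :* u :* x) refl s u (y ℚ.+ d ℚ.* ℓ))
  cancel : ∀ y d ℓ → y ℚ.+ d ℚ.* ℓ ℚ.- y ≡ ℓ ℚ.* d
  cancel = solve 3 (λ y d ℓ → y :+ d :* ℓ :- y := ℓ :* d) refl

-- The integer bound at the single index `M` passes to all later terms of `e`, since the partial
-- sums increase and the other factor is nonnegative.
eSum-bound : ∀ {M m D y L ℓ} → M ≤ m → L ≤ ℓ →
  M ! * (D * y) ≤ eNum M * (y + D * L) → ι D ℚ.* ι y ℚ.≤ eSum m ℚ.* (ι y ℚ.+ ι D ℚ.* ι ℓ)
eSum-bound {M} {m} {D} {y} {L} {ℓ} M≤m L≤ℓ bound = ℚ.≤-trans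
  (ℚ.*-cancelˡ-≤-pos (ι (M !)) {{ι-pos (M !) {{M !≢0}}}} (begin
    ι (M !) ℚ.* (ι D ℚ.* ι y)
      ≡⟨ cong (ι (M !) ℚ.*_) (ι-* D y) ⟨
    ι (M !) ℚ.* ι (D * y)
      ≡⟨ ι-* (M !) (D * y) ⟨
    ι (M ! * (D * y))
      ≤⟨ ι-mono (≤-trans bound (*-monoʳ-≤ (eNum M) (+-monoʳ-≤ y (*-monoʳ-≤ D L≤ℓ)))) ⟩
    ι (eNum M * (y + D * ℓ))
      ≡⟨ ι-* (eNum M) (y + D * ℓ) ⟩
    ι (eNum M) ℚ.* ι (y + D * ℓ)
      ≡⟨ cong₂ ℚ._*_ (sym (eSum*m! M)) (trans (ι-+ y (D * ℓ)) (cong (ι y ℚ.+_) (ι-* D ℓ))) ⟩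
    eSum M ℚ.* ι (M !) ℚ.* z
      ≡⟨ cong (ℚ._* z) (ℚ.*-comm (eSum M) (ι (M !))) ⟩
    ι (M !) ℚ.* eSum M ℚ.* z
      ≡⟨ ℚ.*-assoc (ι (M !)) (eSum M) z ⟩
    ι (M !) ℚ.* (eSum M ℚ.* z) ∎))
  (ℚ.*-monoʳ-≤-nonNeg z {{z-nonNeg}}
    (subst (λ l → eSum M ℚ.≤ eSum l) (m∸n+n≡m M≤m) (eSum-increasing M (m ∸ M))))
  where
  open ℚ.≤-Reasoning
  z = ι y ℚ.+ ι D ℚ.* ι ℓ
  z-nonNeg : ℚ.NonNegative z
  z-nonNeg = subst ℚ.NonNegative (trans (ι-+ y (D * ℓ)) (cong (ι y ℚ.+_) (ι-* D ℓ)))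
    (ι-nonNeg (y + D * ℓ))

fixing-length-bound : ∀ ε δ₀ N {n f L} → let D = ℚ.↧ₙ δ₀; M = 3 * D in
  0ℚ ℚ.< δ₀ → (∀ m → N ≤ m → 0ℚ ℚ.+ δ₀ ℚ.≤ seq ε m) →
  Increasing {n} f → (∀ w → Fixes w f → L ≤ length w) →
  M ! * (D * (n * n)) ≤ eNum M * (n * n + D * L) →
  ∃[ ℓ ] (IsFixingLength f ℓ × fromℕ ℓ ≥ℝ (1/e -ℝ ε) *ℝ fromℕ (n ^ 2))
fixing-length-bound ε δ₀ N {n} {f} {L} 0<δ₀ δ₀≤ε increasing slow L-bound = ℓ , length-ℓ ,
  -- From `N ⊔ M` on the inequality holds term by term, and adding `δ` only weakens it.
  λ δ 0<δ → N ⊔ M , λ m ≤m → ℚ.≤-trans (close m (m⊔n≤o⇒m≤o N M ≤m) (m⊔n≤o⇒n≤o N M ≤m))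
    (subst (ℚ._≤ ι ℓ ℚ.+ δ) (ℚ.+-identityʳ (ι ℓ)) (ℚ.+-monoʳ-≤ (ι ℓ) (ℚ.<⇒≤ 0<δ)))
  where
  D = ℚ.↧ₙ δ₀
  M = 3 * D
  ℓ = proj₁ (fixing-length increasing)
  length-ℓ : IsFixingLength f ℓ
  length-ℓ = proj₂ (fixing-length increasing)
  L≤ℓ : L ≤ ℓ
  L≤ℓ = let (w , w-fixes , w-length) , _ = length-ℓ in subst (L ≤_) w-length (slow w w-fixes)
  close : ∀ m → N ≤ m → M ≤ m → (seq 1/e m ℚ.- seq ε m) ℚ.* ι (n ^ 2) ℚ.≤ ι ℓ
  close m N≤m M≤m = reciprocal-bound {eSum m} {seq 1/e m} {seq ε m} {ι D} {ι (n ^ 2)}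
    {{ℚ.pos⇒nonNeg (seq 1/e m) {{Reciprocal.recip-pos e 0<e m}}}} {{ι-pos D}} {{ι-nonNeg (n ^ 2)}}
    -- The witness `0<e` has shift zero, so the term of `1/e` at `m` is the reciprocal of `eSum m`
    -- itself.
    (Reciprocal.term*recip e 0<e m)
    (ℚ.≤-trans (1≤δ*↧δ δ₀ 0<δ₀) (ℚ.*-monoʳ-≤-nonNeg (ι D) {{ι-nonNeg D}}
      (subst (ℚ._≤ seq ε m) (ℚ.+-identityˡ δ₀) (δ₀≤ε m N≤m))))
    (eSum-bound {M} {m} {D} {n ^ 2} M≤m L≤ℓ
      (subst (λ y → M ! * (D * y) ≤ eNum M * (y + D * L))
        (cong (n *_) (sym (*-identityʳ n))) L-bound))

theorem7 : (ε : ℝ) → 0ℝ <ℝ ε →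
    ∃[ n₀ ] ((n : ℕ) → n ≥ n₀ →
    Σ[ f ∈ Network n ] (Increasing f ×
    (∃[ ℓ ] (IsFixingLength f ℓ ×
    fromℕ ℓ ≥ℝ (1/e -ℝ ε) *ℝ fromℕ (n ^ 2)))))
theorem7 ε (δ₀ , 0<δ₀ , N , δ₀≤ε) =
  -- The terms of `ε` are eventually at least `δ₀`, hence at least the reciprocal of its
  -- denominator, which is the loss allowed in `slow-networks`.
  let n₀ , slow-network-of-size = slow-networks (ℚ.↧ₙ δ₀) in
  n₀ , λ n n≥n₀ →
    let L , (f , increasing , slow) , L-bound = slow-network-of-size n n≥n₀ in
    f , increasing , fixing-length-bound ε δ₀ N 0<δ₀ δ₀≤ε increasing slow L-bound
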